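{- Every data structure that maintains a weighted rooted forest with $n$ vertices under the operations \textsf{subtree-sum} and \textsf{cut} requires $\Omega(n\log n)$ time for $\Theta(n)$ operations, in the Word RAM model of computation and with weight group $G=\mathbb{Z}$.
   Context: The data structure is initialized with a rooted forest $F$ with integer vertex weights $w\colon V(F)\to\mathbb{Z}$ and processes online: $\textsf{cut}(v)$, which deletes the edge between $v$ and its parent (legal only if $v$ is not a root), and $\textsf{subtree-sum}(v)$, which returns the sum of weights of the vertices in the subtree of the current forest rooted at $v$ (i.e., $v$ and all its current descendants). No weight updates are available. The Word RAM has words of $\Theta(\log n)$ bits. -}

module Defs where

open import Data.Bool.Base using (Bool; true; false; if_then_else_; _∧_; _∨_; _xor_)
open import Data.Fin.Base as Fin using (Fin; zero; suc; toℕ)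
open import Data.Fin.Subset using (Subset; _∈_)
open import Data.Integer.Base as ℤ using (ℤ; +_; 0ℤ; _⊖_; _%ℕ_)
open import Data.Integer.Properties using (+-0-monoid)
open import Data.List.Base using (List; []; _∷_; length)
open import Data.Maybe.Base using (Maybe; just; nothing; maybe′)
open import Data.Nat.Base
open import Data.Nat.DivMod using (_mod_)
open import Data.Nat.Logarithm using (⌊log₂_⌋)
open import Data.Nat.Properties using (m^n≢0)
open import Data.Product.Base using (_×_; _,_; ∃; ∃-syntax)
open import Data.Vec.Base as Vec using (Vec; lookup; tabulate; replicate; padRight; _[_]≔_)
open import Data.Vec.Properties using (lookup∘update; lookup∘update′)
open import Function.Bundles using (_⇔_)
open import Relation.Binary.Construct.Closure.ReflexiveTransitive using (Star)
open import Relation.Binary.Construct.Closure.Transitive using (TransClosure; [_]; _∷_)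
open import Relation.Binary.PropositionalEquality using (_≡_; refl; sym; trans)
open import Relation.Nullary using (¬_; yes; no)
import Algebra.Properties.Monoid.Sum as MonoidSum
import Data.Fin.Properties as Fin

open MonoidSum +-0-monoid using (sum)

private
  variable
    n b t t′ R pc : ℕ

------------------------------------------------------------------------
-- Asymptotics

infix 4 _∈Ω_ _∈Θ_

-- The usual real constant c in  f n ≥ c · g n  is 1 / C.
_∈Ω_ : (ℕ → ℕ) → (ℕ → ℕ) → Set
f ∈Ω g = ∃[ C ] ∃[ n₀ ] (0 < C × (∀ n → n₀ ≤ n → g n ≤ C * f n))

_∈Θ_ : (ℕ → ℕ) → (ℕ → ℕ) → Set
f ∈Θ g = f ∈Ω g × g ∈Ω f

------------------------------------------------------------------------
-- Rooted forests

Edge : Vec (Maybe (Fin n)) n → Fin n → Fin n → Set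
Edge parents u p = lookup parents u ≡ just p

record Forest (n : ℕ) : Set where
  field
    parents : Vec (Maybe (Fin n)) n   -- nothing marks a root
    acyclic : ∀ v → ¬ TransClosure (Edge parents) v v

open Forest public

module _ (ps : Vec (Maybe (Fin n)) n) (v : Fin n) where

  edge-uncut : ∀ {u p} → Edge (ps [ v ]≔ nothing) u p → Edge ps u p
  edge-uncut {u} e with u Fin.≟ v
  ... | no  u≢v = trans (sym (lookup∘update′ u≢v ps nothing)) e
  ... | yes refl with trans (sym (lookup∘update v ps nothing)) e
  ...   | ()

  path-uncut : ∀ {u p} → TransClosure (Edge (ps [ v ]≔ nothing)) u p →
               TransClosure (Edge ps) u p
  path-uncut [ e ]   = [ edge-uncut e ]
  path-uncut (e ∷ p) = edge-uncut e ∷ path-uncut p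

deleteParentEdge : Forest n → Fin n → Forest n
deleteParentEdge F v = record
  { parents = parents F [ v ]≔ nothing
  ; acyclic = λ u p → acyclic F u (path-uncut (parents F) v p)
  }

Weights : ℕ → Set
Weights n = Fin n → ℤ

Descendant : Forest n → Fin n → Fin n → Set
Descendant F v u = Star (Edge (parents F)) u v

SubtreeSum : Forest n → Weights n → Fin n → ℤ → Set
SubtreeSum {n} F w v s = ∃ λ (S : Subset n) →
  (∀ u → u ∈ S ⇔ Descendant F v u) ×
  s ≡ sum (λ u → if lookup S u then w u else 0ℤ)

data Operation (n : ℕ) : Set where
  cut subtree-sum : Fin n → Operation n

-- History w F os as : os is a legal operation sequence on the forest F, and
-- as lists the correct answers to its subtree-sum operations, in order.
data History (w : Weights n) : Forest n → List (Operation n) → List ℤ → Set where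
  []          : ∀ {F} → History w F [] []
  cut         : ∀ {F v p os as} → Edge (parents F) v p →
                History w (deleteParentEdge F v) os as →
                History w F (cut v ∷ os) as
  subtree-sum : ∀ {F v a os as} → SubtreeSum F w v a →
                History w F os as →
                History w F (subtree-sum v ∷ os) (a ∷ as)

------------------------------------------------------------------------
-- Words

Word : ℕ → Set
Word b = Fin (2 ^ b)

word : ∀ b → ℕ → Word b
word b k = _mod_ k (2 ^ b) {{m^n≢0 2 b}}

bitwise : (Bool → Bool → Bool) → ℕ → ℕ → ℕ → ℕ
bitwise f zero    x y = 0
bitwise f (suc b) x y =
  (if f (x % 2 ≡ᵇ 1) (y % 2 ≡ᵇ 1) then 1 else 0) + 2 * bitwise f b (x / 2) (y / 2)

data BinOp : Set where
  add sub mul mulHigh div mod and or xor shl shr eq lt : BinOp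

-- Division and remainder by 0 return 0.
evalℕ : BinOp → ℕ → ℕ → ℕ → ℕ
evalℕ add     b x y       = x + y
evalℕ sub     b x y       = x + (2 ^ b ∸ y)
evalℕ mul     b x y       = x * y
evalℕ mulHigh b x y       = _/_ (x * y) (2 ^ b) {{m^n≢0 2 b}}
evalℕ div     b x zero    = 0
evalℕ div     b x (suc y) = x / suc y
evalℕ mod     b x zero    = 0
evalℕ mod     b x (suc y) = x % suc y
evalℕ and     b x y       = bitwise _∧_ b x y
evalℕ or      b x y       = bitwise _∨_ b x y
evalℕ xor     b x y       = bitwise _xor_ b x y
evalℕ shl     b x y       = x * 2 ^ y
evalℕ shr     b x y       = _/_ x (2 ^ y) {{m^n≢0 2 y}}
evalℕ eq      b x y       = if x ≡ᵇ y then 1 else 0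
evalℕ lt      b x y       = if x <ᵇ y then 1 else 0

eval : ∀ b → BinOp → Word b → Word b → Word b
eval b o x y = word b (evalℕ o b (toℕ x) (toℕ y))

-- The integers with a two's complement representation in a b-bit word.
FitsWord : ℕ → ℤ → Set
FitsWord b z = (ℤ.- (+ (2 ^ (b ∸ 1))) ℤ.≤ z) × (z ℤ.< + (2 ^ (b ∸ 1)))

encode : ∀ b → ℤ → Word b
encode b z = word b (_%ℕ_ z (2 ^ b) {{m^n≢0 2 b}})

-- The integer with two's complement representation x < 2 ^ k on k bits.
decode : ℕ → ℕ → ℤ
decode k x = if x <ᵇ 2 ^ (k ∸ 1) then + x else x ⊖ 2 ^ k

------------------------------------------------------------------------
-- Word RAM with R registers and b-bit words

data Instruction (R : ℕ) : Set where
  const      : Fin R → ℕ → Instruction R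
  binop      : BinOp → Fin R → Fin R → Fin R → Instruction R
  load       : Fin R → Fin R → Instruction R
  store      : Fin R → Fin R → Instruction R
  jumpIfZero : Fin R → ℕ → Instruction R

Program : ℕ → Set
Program R = List (Instruction R)

record Machine (R b : ℕ) : Set where
  constructor machine
  field
    registers : Vec (Word b) R
    memory    : Vec (Word b) (2 ^ b)

open Machine public

fetch : Program R → ℕ → Maybe (Instruction R)
fetch []      _        = nothing
fetch (i ∷ P) zero     = just i
fetch (i ∷ P) (suc pc) = fetch P pc

-- The destination register comes first; store a s writes register s to the
-- memory cell addressed by register a.
execute : Instruction R → ℕ → Machine R b → ℕ × Machine R b
execute {b = b} (const d k) pc (machine ρ μ) =
  suc pc , machine (ρ [ d ]≔ word b k) μ
execute {b = b} (binop o d x y) pc (machine ρ μ) =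
  suc pc , machine (ρ [ d ]≔ eval b o (lookup ρ x) (lookup ρ y)) μ
execute (load d a) pc (machine ρ μ) =
  suc pc , machine (ρ [ d ]≔ lookup μ (lookup ρ a)) μ
execute (store a s) pc (machine ρ μ) =
  suc pc , machine ρ (μ [ lookup ρ a ]≔ lookup ρ s)
execute (jumpIfZero x ℓ) pc (machine ρ μ) =
  (if toℕ (lookup ρ x) ≡ᵇ 0 then ℓ else suc pc) , machine ρ μ

infix 4 _⊢_⇓[_]_

-- P ⊢ (pc , M) ⇓[ t ] M′ : started at instruction pc on M, the program P
-- halts (by leaving its instruction list) on M′ after t unit-cost instructions.
data _⊢_⇓[_]_ (P : Program R) : ℕ × Machine R b → ℕ → Machine R b → Set where
  halt : ∀ {M : Machine R b} → fetch P pc ≡ nothing → P ⊢ (pc , M) ⇓[ 0 ] M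
  step : ∀ {i} {M M′ : Machine R b} → fetch P pc ≡ just i →
         P ⊢ execute i pc M ⇓[ t ] M′ → P ⊢ (pc , M) ⇓[ suc t ] M′

------------------------------------------------------------------------
-- Data structures on the Word RAM

-- Fixed programs, independent of n and of the word size.
record DataStructure : Set where
  field
    extraRegisters : ℕ
  registerCount : ℕ
  registerCount = 2 + extraRegisters
  field
    initProgram       : Program registerCount
    cutProgram        : Program registerCount
    subtreeSumProgram : Program registerCount

open DataStructure public

-- n + n cells hold the input of the initialization, a parent and a weight per
-- vertex; in particular every vertex fits in a word.
record WordSize : Set where
  field
    bits      : ℕ → ℕ
    bits∈Θlog : bits ∈Θ ⌊log₂_⌋
    room      : ∀ n → n + n ≤ 2 ^ bits n

open WordSize public

module _ (W : WordSize) (D : DataStructure) where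

  State : ℕ → Set
  State n = Machine (registerCount D) (bits W n)

  -- Cell v holds the parent of v, or n if v is a root; cell n + v holds the
  -- weight of v; all other cells are 0. Register 0 holds n.
  input : Forest n → Weights n → State n
  input {n} F w = machine
    (replicate _ (word (bits W n) 0) [ zero ]≔ word (bits W n) n)
    (padRight (room W n) (word (bits W n) 0)
      (Vec.map (λ p → word (bits W n) (maybe′ toℕ n p)) (parents F)
        Vec.++ tabulate (λ v → encode (bits W n) (w v))))

  -- The vertex is passed in register 0; everything else persists.
  call : Fin n → State n → State n
  call {n} v (machine ρ μ) = machine (ρ [ zero ]≔ word (bits W n) (toℕ v)) μ

  -- A sum of n word-sized weights may overflow one word but not two: register 0
  -- returns the low half and register 1 the high half.
  answer : State n → ℤ
  answer {n} (machine ρ _) = decode (bits W n + bits W n)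
    (toℕ (lookup ρ zero) + 2 ^ bits W n * toℕ (lookup ρ (suc zero)))

  Initialized : Forest n → Weights n → State n → Set
  Initialized F w M = ∃[ t ] (initProgram D ⊢ (0 , input F w) ⇓[ t ] M)

  -- Serves M os as t : from state M, processing os online returns the answers
  -- as and takes t time steps in total.
  data Serves {n : ℕ} : State n → List (Operation n) → List ℤ → ℕ → Set where
    []          : ∀ {M} → Serves M [] [] 0
    cut         : ∀ {M M′ v os as} →
                  cutProgram D ⊢ (0 , call v M) ⇓[ t ] M′ →
                  Serves M′ os as t′ →
                  Serves M (cut v ∷ os) as (t + t′)
    subtree-sum : ∀ {M M′ v os as} →
                  subtreeSumProgram D ⊢ (0 , call v M) ⇓[ t ] M′ →
                  Serves M′ os as t′ →
                  Serves M (subtree-sum v ∷ os) (answer M′ ∷ as) (t + t′)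

  Maintains : Set
  Maintains = ∀ {n} (F : Forest n) (w : Weights n) → (∀ v → FitsWord (bits W n) (w v)) →
    ∃[ M ] (Initialized F w M ×
            (∀ {os as} → History w F os as → ∃[ t ] Serves M os as t))

  -- T n bounds the total time of any m n legal operations, not counting the
  -- initialization.
  TimeBound : (m T : ℕ → ℕ) → Set
  TimeBound m T = ∀ {n} (F : Forest n) (w : Weights n) → (∀ v → FitsWord (bits W n) (w v)) →
    ∀ {M os as t} → Initialized F w M → History w F os as → length os ≡ m n →
    Serves M os as t → t ≤ T n

{-# OPTIONS --safe #-}

-- The proof is an information transfer argument. The forest is a path of k = 2 ^ h
-- vertices with many leaves at each path vertex, so that cutting a leaf of the i-th path
-- vertex changes exactly the subtree sums at the positions up to i. In one
-- round every position is visited once, in bit-reversal order; a visit cuts one of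
-- K = 2 ^ h candidate leaves at that position and then queries the position. The visits of
-- a round are the leaves of a binary tree. At a node with 2 ^ l visits in each half, the
-- answers in the second half determine all cuts of the first half. On the other hand they
-- are a function of the state before the first half, the registers between the halves, and
-- the contents of the memory cells touched in both halves. Hence, if few cells are touched
-- in both halves, the choices of the round have a short description, and by the pigeonhole
-- principle some choices make all sufficiently high nodes of the tree expensive at once.
-- The numbers of cells shared at the nodes add up to at most the running time, because
-- ∣ S₁ ∪ S₀ ∣ + ∣ S₁ ∩ S₀ ∣ = ∣ S₁ ∣ + ∣ S₀ ∣ telescopes along the tree. A round thus costs
-- Ω (k log k) for 2 k operations, and Θ (k) rounds fit into n = Θ (k ²) vertices if each
-- cut candidate is replaced by a fresh leaf.

module Submission where

open import Algebra.Properties.AbelianGroup using (∙-cancelˡ)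
open import Data.Bool.Base using (true; false; if_then_else_; _∧_; not)
open import Data.Empty using (⊥)
open import Data.Fin.Base using (Fin; zero; suc; toℕ)
open import Data.Fin.Subset using (Subset; _⊆_; _∪_; _∩_; _-_; ∣_∣; ⁅_⁆) renaming (_∈_ to _∈ₛ_; _∉_ to _∉ₛ_; ⊥ to ∅)
open import Data.Fin.Subset.Properties using (nonempty?; Empty-unique; x∈p⇒∣p-x∣<∣p∣; p─q⊆p; x∈p∧x≢y⇒x∈p-y; ∣⊥∣≡0; ∣⁅x⁆∣≡1; x∈⁅x⁆; x∈p∩q⁺; x∈p∩q⁻; ∪-assoc; ∪-identityˡ; p⊆p∪q; q⊆p∪q) renaming (_∈?_ to _∈ₛ?_)
open import Data.Integer.Base as ℤ using (ℤ; +_; 0ℤ; +<+)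
open import Data.List.Base using (List; []; _∷_; _++_; length; map; replicate)
open import Data.List.Membership.Propositional using (_∈_; _∉_)
open import Data.List.Membership.Propositional.Properties using (∈-++⁻)
open import Data.List.Properties using (++-assoc; ++-cancelˡ; ++-cancelʳ; ∷-injective; length-++; length-replicate; map-++)
open import Data.List.Relation.Unary.All as All using (All; []; _∷_)
open import Data.List.Relation.Unary.AllPairs using ([]; _∷_)
open import Data.List.Relation.Unary.Any using (here; there)
open import Data.List.Relation.Unary.Unique.Propositional using (Unique)
open import Data.Maybe.Base using (Maybe; just; nothing)
open import Data.Maybe.Properties using (just-injective)
open import Data.Nat.Base
open import Data.Nat.DivMod using (_mod_; m<n⇒m%n≡m; m%n<n; [m+kn]%n≡m%n)
open import Data.Nat.ListAction using () renaming (sum to listSum)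
open import Data.Nat.ListAction.Properties using () renaming (sum-++ to listSum-++)
open import Data.Nat.Logarithm
open import Data.Nat.Properties
open import Data.Nat.Tactic.RingSolver using (solve-∀)
open import Data.Product.Base using (_×_; _,_; ∃; ∃-syntax; proj₁; proj₂)
open import Data.Product.Function.NonDependent.Propositional using (_×-↣_)
open import Data.Sum.Base using (_⊎_; inj₁; inj₂)
open import Data.Sum.Function.Propositional using (_⊎-↣_)
open import Data.Vec.Base using (Vec; []; _∷_; lookup; tabulate; _[_]≔_)
open import Data.Vec.Properties using (lookup∘update; lookup∘update′; lookup∘tabulate; []=⇒lookup; lookup⇒[]=)
open import Function.Base using (_∘_; _$_)
open import Function.Bundles using (_↣_; mk↣; mk⇔; Injection)
open import Function.Construct.Composition using (_↣-∘_)
open import Function.Construct.Identity using (↣-id)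
open import Function.Properties.Inverse using (↔⇒↣; ↔-sym)
open import Relation.Binary.Construct.Closure.ReflexiveTransitive using (Star; ε; _◅_)
open import Relation.Binary.Construct.Closure.Transitive using (TransClosure; [_]; _∷_)
open import Relation.Binary.PropositionalEquality
open import Relation.Nullary using (yes; no; does; contradiction)
open import Defs

import Algebra.Properties.Monoid.Sum as MonoidSum
import Data.Fin.Properties as Fin
import Data.Integer.Properties as ℤ
import Data.List.Membership.DecPropositional as DecMembership
import Data.List.Relation.Unary.All.Properties as All

open MonoidSum ℤ.+-0-monoid using (sum; sum-cong-≗)

private
  variable
    N a b R pc t t′ : ℕ
    A B : Set

-- Cardinalities of subsets, and vectors edited in few places

∣p∪q∣+∣p∩q∣≡∣p∣+∣q∣ : ∀ (p q : Subset N) → ∣ p ∪ q ∣ + ∣ p ∩ q ∣ ≡ ∣ p ∣ + ∣ q ∣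
∣p∪q∣+∣p∩q∣≡∣p∣+∣q∣ []          []          = refl
∣p∪q∣+∣p∩q∣≡∣p∣+∣q∣ (true  ∷ p) (true  ∷ q) = cong suc $
  trans (+-suc _ _) (trans (cong suc (∣p∪q∣+∣p∩q∣≡∣p∣+∣q∣ p q)) (sym (+-suc _ _)))
∣p∪q∣+∣p∩q∣≡∣p∣+∣q∣ (true  ∷ p) (false ∷ q) = cong suc (∣p∪q∣+∣p∩q∣≡∣p∣+∣q∣ p q)
∣p∪q∣+∣p∩q∣≡∣p∣+∣q∣ (false ∷ p) (true  ∷ q) =
  trans (cong suc (∣p∪q∣+∣p∩q∣≡∣p∣+∣q∣ p q)) (sym (+-suc _ _))
∣p∪q∣+∣p∩q∣≡∣p∣+∣q∣ (false ∷ p) (false ∷ q) = ∣p∪q∣+∣p∩q∣≡∣p∣+∣q∣ p q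

∣p∪q∣≤∣p∣+∣q∣ : ∀ (p q : Subset N) → ∣ p ∪ q ∣ ≤ ∣ p ∣ + ∣ q ∣
∣p∪q∣≤∣p∣+∣q∣ p q = ≤-trans (m≤m+n _ _) (≤-reflexive (∣p∪q∣+∣p∩q∣≡∣p∣+∣q∣ p q))

_⊨_≈_ : Subset N → Vec A N → Vec A N → Set
S ⊨ μ ≈ ν = ∀ {c} → c ∈ₛ S → lookup μ c ≡ lookup ν c

≈-update : ∀ {S : Subset N} {μ ν : Vec A N} d {a} → S ⊨ μ ≈ ν → S ⊨ (μ [ d ]≔ a) ≈ (ν [ d ]≔ a)
≈-update {μ = μ} {ν} d μ≈ν {c} c∈S with c Fin.≟ d
... | yes refl = trans (lookup∘update c μ _) (sym (lookup∘update c ν _))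
... | no c≢d   = trans (lookup∘update′ c≢d μ _) (trans (μ≈ν c∈S) (sym (lookup∘update′ c≢d ν _)))

patch : ∀ {q} → Vec (Fin N × A) q → Vec A N → Vec A N
patch []             μ = μ
patch ((c , a) ∷ es) μ = patch es μ [ c ]≔ a

-- Unused edits rewrite cell c₀ with the value it already has.
patch-exists : ∀ q (S : Subset N) → ∣ S ∣ ≤ q → Fin N → (μ ν : Vec A N) →
  ∃ λ (es : Vec (Fin N × A) q) →
    (∀ {c} → c ∈ₛ S → lookup (patch es μ) c ≡ lookup ν c) ×
    (∀ {c} → c ∉ₛ S → lookup (patch es μ) c ≡ lookup μ c)
patch-exists zero S ∣S∣≤0 c₀ μ ν =
  [] , (λ c∈S → contradiction (<-≤-trans (x∈p⇒∣p-x∣<∣p∣ c∈S) ∣S∣≤0) λ ()) , λ _ → refl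
patch-exists {N} (suc q) S ∣S∣≤ c₀ μ ν with nonempty? S
... | yes (a , a∈S)
  with es , on , off ← patch-exists q (S - a) (≤-pred (<-≤-trans (x∈p⇒∣p-x∣<∣p∣ a∈S) ∣S∣≤)) c₀ μ ν
  = (a , lookup ν a) ∷ es , on′ , off′
  where
  on′ : ∀ {c} → c ∈ₛ S → lookup (patch es μ [ a ]≔ lookup ν a) c ≡ lookup ν c
  on′ {c} c∈S with c Fin.≟ a
  ... | yes refl = lookup∘update a (patch es μ) _
  ... | no c≢a   = trans (lookup∘update′ c≢a (patch es μ) _) (on (x∈p∧x≢y⇒x∈p-y c∈S c≢a))
  off′ : ∀ {c} → c ∉ₛ S → lookup (patch es μ [ a ]≔ lookup ν a) c ≡ lookup μ c
  off′ {c} c∉S = trans (lookup∘update′ (λ { refl → c∉S a∈S }) (patch es μ) _)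
                       (off (c∉S ∘ p─q⊆p S ⁅ a ⁆))
... | no empty
  with es , on , off ← patch-exists q S
         (≤-trans (≤-reflexive (trans (cong ∣_∣ (Empty-unique empty)) (∣⊥∣≡0 N))) z≤n) c₀ μ ν
  = (c₀ , lookup μ c₀) ∷ es , (λ c∈S → contradiction (_ , c∈S) empty) , λ _ → off′
  where
  off′ : ∀ {c} → lookup (patch es μ [ c₀ ]≔ lookup μ c₀) c ≡ lookup μ c
  off′ {c} with c Fin.≟ c₀
  ... | yes refl = lookup∘update c (patch es μ) _
  ... | no c≢c₀  = trans (lookup∘update′ c≢c₀ (patch es μ) _) (off λ c∈S → empty (_ , c∈S))

-- Locality of Word RAM programs

accessed : Instruction R → Machine R b → Subset (2 ^ b)
accessed (load _ a)  (machine ρ _) = ⁅ lookup ρ a ⁆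
accessed (store a _) (machine ρ _) = ⁅ lookup ρ a ⁆
accessed _           _             = ∅

∣accessed∣≤1 : ∀ (i : Instruction R) (M : Machine R b) → ∣ accessed i M ∣ ≤ 1
∣accessed∣≤1 {b = b} (const _ _)      M = ≤-trans (≤-reflexive (∣⊥∣≡0 (2 ^ b))) z≤n
∣accessed∣≤1 {b = b} (binop _ _ _ _)  M = ≤-trans (≤-reflexive (∣⊥∣≡0 (2 ^ b))) z≤n
∣accessed∣≤1         (load _ a)       M = ≤-reflexive (∣⁅x⁆∣≡1 (lookup (registers M) a))
∣accessed∣≤1         (store a _)      M = ≤-reflexive (∣⁅x⁆∣≡1 (lookup (registers M) a))
∣accessed∣≤1 {b = b} (jumpIfZero _ _) M = ≤-trans (≤-reflexive (∣⊥∣≡0 (2 ^ b))) z≤n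

infixl 6 _withMemory_

_withMemory_ : Machine R b → Vec (Word b) (2 ^ b) → Machine R b
machine ρ _ withMemory ν = machine ρ ν

-- Registers and control flow depend on the memory only through `load`, whose cell lies in `S`, and
-- a `store` writes the same value to the same address in both memories. The set `S` stays fixed, so
-- the agreement can be carried through a whole execution.
execute-local : ∀ (i : Instruction R) pc (M : Machine R b) {S ν} →
  accessed i M ⊆ S → S ⊨ memory M ≈ ν →
  ∃ λ ν′ → execute i pc (M withMemory ν) ≡
             (proj₁ (execute i pc M) , proj₂ (execute i pc M) withMemory ν′) ×
           S ⊨ memory (proj₂ (execute i pc M)) ≈ ν′
execute-local (const d k)      pc M _   μ≈ν = _ , refl , μ≈ν
execute-local (binop o d x y)  pc M _   μ≈ν = _ , refl , μ≈ν
execute-local (load d a)       pc (machine ρ μ) {ν = ν} i⊆S μ≈ν =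
  ν , cong (λ w → suc pc , machine (ρ [ d ]≔ w) ν) (sym (μ≈ν (i⊆S (x∈⁅x⁆ _)))) , μ≈ν
execute-local (store a s)      pc (machine ρ μ) {ν = ν} _ μ≈ν =
  _ , refl , ≈-update {μ = μ} {ν} (lookup ρ a) μ≈ν
execute-local (jumpIfZero x ℓ) pc M _   μ≈ν = _ , refl , μ≈ν

execute-frame : ∀ (i : Instruction R) pc (M : Machine R b) {c} → c ∉ₛ accessed i M →
  lookup (memory (proj₂ (execute i pc M))) c ≡ lookup (memory M) c
execute-frame (const _ _)      pc M _ = refl
execute-frame (binop _ _ _ _)  pc M _ = refl
execute-frame (load _ _)       pc M _ = refl
execute-frame (store a s)      pc (machine ρ μ) c∉ =
  lookup∘update′ (λ { refl → c∉ (x∈⁅x⁆ _) }) μ _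
execute-frame (jumpIfZero _ _) pc M _ = refl

module _ {P : Program R} where

  touched : ∀ {s} {M′ : Machine R b} → P ⊢ s ⇓[ t ] M′ → Subset (2 ^ b)
  touched (halt _)                   = ∅
  touched (step {i = i} {M = M} _ d) = accessed i M ∪ touched d

  ∣touched∣≤t : ∀ {s} {M′ : Machine R b} (d : P ⊢ s ⇓[ t ] M′) → ∣ touched d ∣ ≤ t
  ∣touched∣≤t {b = b} (halt _)           = ≤-reflexive (∣⊥∣≡0 (2 ^ b))
  ∣touched∣≤t (step {i = i} {M = M} _ d) =
    ≤-trans (∣p∪q∣≤∣p∣+∣q∣ (accessed i M) (touched d)) (+-mono-≤ (∣accessed∣≤1 i M) (∣touched∣≤t d))

  ⇓-local : ∀ {M M′ : Machine R b} {S ν} (d : P ⊢ (pc , M) ⇓[ t ] M′) →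
    touched d ⊆ S → S ⊨ memory M ≈ ν →
    ∃ λ ν′ → P ⊢ (pc , M withMemory ν) ⇓[ t ] (M′ withMemory ν′) × S ⊨ memory M′ ≈ ν′
  ⇓-local (halt stop) _ μ≈ν = _ , halt stop , μ≈ν
  ⇓-local {pc = pc} {M = M} {ν = ν} (step {i = i} fetched d) d⊆S μ≈ν
    with ν₁ , same , μ≈ν₁ ← execute-local i pc M {ν = ν} (d⊆S ∘ p⊆p∪q _) μ≈ν
    with ν′ , d′ , μ≈ν′ ← ⇓-local d (d⊆S ∘ q⊆p∪q (accessed i M) _) μ≈ν₁
    = ν′ , step fetched (subst (λ s → P ⊢ s ⇓[ _ ] _) (sym same) d′) , μ≈ν′

  ⇓-frame : ∀ {M M′ : Machine R b} (d : P ⊢ (pc , M) ⇓[ t ] M′) {c} → c ∉ₛ touched d →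
    lookup (memory M′) c ≡ lookup (memory M) c
  ⇓-frame (halt _) _ = refl
  ⇓-frame {pc = pc} {M = M} (step {i = i} _ d) c∉ =
    trans (⇓-frame d (c∉ ∘ q⊆p∪q (accessed i M) _)) (execute-frame i pc M (c∉ ∘ p⊆p∪q _))

  ⇓-deterministic : ∀ {s} {M M′ : Machine R b} → P ⊢ s ⇓[ t ] M → P ⊢ s ⇓[ t′ ] M′ → M ≡ M′
  ⇓-deterministic (halt _)    (halt _)    = refl
  ⇓-deterministic (halt f)    (step g _)  with () ← trans (sym f) g
  ⇓-deterministic (step f _)  (halt g)    with () ← trans (sym f) g
  ⇓-deterministic (step f d)  (step g d′)
    with refl ← just-injective (trans (sym f) g) = ⇓-deterministic d d′

-- Executions of operation sequences

module _ (W : WordSize) (D : DataStructure) {n : ℕ} where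

  -- `Serves` exposes neither the final state nor the touched cells. Both are indices here, so that
  -- the runs of two halves can be concatenated and their cell sets intersected.
  data Exec : State W D n → List (Operation n) → List ℤ →
              Subset (2 ^ bits W n) → ℕ → State W D n → Set where
    []          : ∀ {M} → Exec M [] [] ∅ 0 M
    cut         : ∀ {M M₁ M′ v os as S} (d : cutProgram D ⊢ (0 , call W D v M) ⇓[ t ] M₁) →
                  Exec M₁ os as S t′ M′ →
                  Exec M (cut v ∷ os) as (touched d ∪ S) (t + t′) M′
    subtree-sum : ∀ {M M₁ M′ v os as S} (d : subtreeSumProgram D ⊢ (0 , call W D v M) ⇓[ t ] M₁) →
                  Exec M₁ os as S t′ M′ →
                  Exec M (subtree-sum v ∷ os) (answer W D M₁ ∷ as) (touched d ∪ S) (t + t′) M′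

  private
    variable
      M M₁ M′ : State W D n
      os os′ : List (Operation n)
      as as′ : List ℤ
      S S′ : Subset (2 ^ bits W n)

  Exec-cast : S ≡ S′ → t ≡ t′ → Exec M os as S t M′ → Exec M os as S′ t′ M′
  Exec-cast refl refl e = e

  Exec-++ : Exec M os as S t M₁ → Exec M₁ os′ as′ S′ t′ M′ →
            Exec M (os ++ os′) (as ++ as′) (S ∪ S′) (t + t′) M′
  Exec-++ [] e′ = Exec-cast (sym (∪-identityˡ _)) refl e′
  Exec-++ (cut {t = t} {t′ = u} d e) e′ =
    Exec-cast (sym (∪-assoc (touched d) _ _)) (sym (+-assoc t u _))
      (cut d (Exec-++ e e′))
  Exec-++ (subtree-sum {t = t} {t′ = u} d e) e′ =
    Exec-cast (sym (∪-assoc (touched d) _ _)) (sym (+-assoc t u _))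
      (subtree-sum d (Exec-++ e e′))

  Exec⇒Serves-++ : Exec M os as S t M₁ → Serves W D M₁ os′ as′ t′ →
                   Serves W D M (os ++ os′) (as ++ as′) (t + t′)
  Exec⇒Serves-++ [] s = s
  Exec⇒Serves-++ (cut {t = t} {t′ = u} d e) s =
    subst (Serves W D _ _ _) (sym (+-assoc t u _)) (cut d (Exec⇒Serves-++ e s))
  Exec⇒Serves-++ (subtree-sum {t = t} {t′ = u} d e) s =
    subst (Serves W D _ _ _) (sym (+-assoc t u _)) (subtree-sum d (Exec⇒Serves-++ e s))

  Serves-split : ∀ os {as} → Serves W D M (os ++ os′) as t →
    ∃[ as₁ ] ∃[ as₂ ] ∃[ S ] ∃[ t₁ ] ∃[ t₂ ] ∃[ M₁ ]
      (as ≡ as₁ ++ as₂ × Exec M os as₁ S t₁ M₁ × Serves W D M₁ os′ as₂ t₂)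
  Serves-split [] s = _ , _ , _ , _ , _ , _ , refl , [] , s
  Serves-split (cut v ∷ os) (cut d s)
    with _ , _ , _ , _ , _ , _ , same , e , s′ ← Serves-split os s
    = _ , _ , _ , _ , _ , _ , same , cut d e , s′
  Serves-split (subtree-sum v ∷ os) (subtree-sum d s)
    with _ , _ , _ , _ , _ , _ , same , e , s′ ← Serves-split os s
    = _ , _ , _ , _ , _ , _ , cong (_ ∷_) same , subtree-sum d e , s′

  Exec-∣S∣≤t : Exec M os as S t M′ → ∣ S ∣ ≤ t
  Exec-∣S∣≤t [] = ≤-reflexive (∣⊥∣≡0 (2 ^ bits W n))
  Exec-∣S∣≤t (cut {S = S} d e) =
    ≤-trans (∣p∪q∣≤∣p∣+∣q∣ (touched d) S) (+-mono-≤ (∣touched∣≤t d) (Exec-∣S∣≤t e))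
  Exec-∣S∣≤t (subtree-sum {S = S} d e) =
    ≤-trans (∣p∪q∣≤∣p∣+∣q∣ (touched d) S) (+-mono-≤ (∣touched∣≤t d) (Exec-∣S∣≤t e))

  Exec-deterministic : Exec M os as S t M₁ → Exec M os as′ S′ t′ M′ → as ≡ as′ × M₁ ≡ M′
  Exec-deterministic [] [] = refl , refl
  Exec-deterministic (cut d e) (cut d′ e′)
    with refl ← ⇓-deterministic d d′ = Exec-deterministic e e′
  Exec-deterministic (subtree-sum d e) (subtree-sum d′ e′)
    with refl ← ⇓-deterministic d d′
    with refl , same ← Exec-deterministic e e′ = refl , same

  Exec-frame : Exec M os as S t M′ → ∀ {c} → c ∉ₛ S → lookup (memory M′) c ≡ lookup (memory M) c
  Exec-frame [] _ = refl
  Exec-frame (cut d e) c∉ =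
    trans (Exec-frame e (c∉ ∘ q⊆p∪q (touched d) _)) (⇓-frame d (c∉ ∘ p⊆p∪q _))
  Exec-frame (subtree-sum d e) c∉ =
    trans (Exec-frame e (c∉ ∘ q⊆p∪q (touched d) _)) (⇓-frame d (c∉ ∘ p⊆p∪q _))

  -- Of the run on the other memory only the answers are recorded: they are what the decoding
  -- compares.
  Exec-local : ∀ {V ν} → Exec M os as S t M′ → S ⊆ V → V ⊨ memory M ≈ ν →
    ∃[ S′ ] ∃[ t′ ] ∃[ M″ ] Exec (M withMemory ν) os as S′ t′ M″
  Exec-local [] _ _ = _ , _ , _ , []
  Exec-local {ν = ν} (cut d e) ⊆V μ≈ν
    with ν₁ , d′ , μ≈ν₁ ← ⇓-local {ν = ν} d (⊆V ∘ p⊆p∪q _) μ≈ν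
    with _ , _ , _ , e′ ← Exec-local e (⊆V ∘ q⊆p∪q (touched d) _) μ≈ν₁
    = _ , _ , _ , cut d′ e′
  Exec-local {ν = ν} (subtree-sum d e) ⊆V μ≈ν
    with ν₁ , d′ , μ≈ν₁ ← ⇓-local {ν = ν} d (⊆V ∘ p⊆p∪q _) μ≈ν
    with _ , _ , _ , e′ ← Exec-local e (⊆V ∘ q⊆p∪q (touched d) _) μ≈ν₁
    = _ , _ , _ , subtree-sum d′ e′

  Servable : Weights n → Forest n → State W D n → Set
  Servable w F M = ∀ {os as} → History w F os as → ∃[ t ] Serves W D M os as t

  -- `Servable` yields a separate run for each complete sequence. Serving `os` alone fixes `M₁`; the
  -- run for any longer sequence passes through the same `M₁` by determinism, so its remainder
  -- serves the continuation from there.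
  Servable-advance : ∀ {w F F′ M os as} → Servable w F M →
    (∀ {os′ as′} → History w F′ os′ as′ → History w F (os ++ os′) (as ++ as′)) →
    ∃[ S ] ∃[ t ] ∃[ M₁ ] (Exec M os as S t M₁ × Servable w F′ M₁)
  Servable-advance {os = os} {as} serve extend
    with _ , s ← serve (extend [])
    with _ , _ , _ , _ , _ , _ , same , e , [] ← Serves-split os s
    with refl ← ++-cancelʳ [] as _ same
    = _ , _ , _ , e , serve′
    where
    serve′ : Servable _ _ _
    serve′ h
      with _ , s′ ← serve (extend h)
      with _ , _ , _ , _ , _ , _ , same′ , e′ , s″ ← Serves-split os s′
      with refl , refl ← Exec-deterministic e e′
      with refl ← ++-cancelˡ as _ _ same′
      = _ , s″

sum-remove : ∀ {n} (f g : Fin n → ℤ) c → (∀ u → u ≢ c → f u ≡ g u) → g c ≡ 0ℤ →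
             sum g ℤ.+ f c ≡ sum f
sum-remove f g zero agree gc≡0 = begin
  g zero ℤ.+ sum (g ∘ suc) ℤ.+ f zero  ≡⟨ cong (λ z → z ℤ.+ sum (g ∘ suc) ℤ.+ f zero) gc≡0 ⟩
  0ℤ ℤ.+ sum (g ∘ suc) ℤ.+ f zero      ≡⟨ cong (ℤ._+ f zero) (ℤ.+-identityˡ (sum (g ∘ suc))) ⟩
  sum (g ∘ suc) ℤ.+ f zero             ≡⟨ ℤ.+-comm _ (f zero) ⟩
  f zero ℤ.+ sum (g ∘ suc)             ≡⟨ cong (ℤ._+_ (f zero)) (sum-cong-≗ λ u → sym (agree (suc u) λ ())) ⟩
  f zero ℤ.+ sum (f ∘ suc)             ∎
  where open ≡-Reasoning
sum-remove f g (suc c) agree gc≡0 = begin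
  g zero ℤ.+ sum (g ∘ suc) ℤ.+ f (suc c)    ≡⟨ ℤ.+-assoc (g zero) _ _ ⟩
  g zero ℤ.+ (sum (g ∘ suc) ℤ.+ f (suc c))  ≡⟨ cong₂ ℤ._+_ (sym (agree zero λ ())) rest ⟩
  f zero ℤ.+ sum (f ∘ suc)                  ∎
  where
  open ≡-Reasoning
  rest : sum (g ∘ suc) ℤ.+ f (suc c) ≡ sum (f ∘ suc)
  rest = sum-remove (f ∘ suc) (g ∘ suc) c (λ u u≢c → agree (suc u) (u≢c ∘ Fin.suc-injective)) gc≡0

-- The forest

module Caterpillar (n k : ℕ) .{{_ : NonZero n}} .{{_ : NonZero k}} (k≤n : k ≤ n) where

  open DecMembership (Fin._≟_ {n}) using (_∈?_)

  vertex : ℕ → Fin n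
  vertex i = _mod_ i n

  toℕ-vertex : ∀ {i} → i < n → toℕ (vertex i) ≡ i
  toℕ-vertex i<n = trans (Fin.toℕ-fromℕ< _) (m<n⇒m%n≡m i<n)

  vertex-toℕ : ∀ u → vertex (toℕ u) ≡ u
  vertex-toℕ u = Fin.toℕ-injective (toℕ-vertex (Fin.toℕ<n u))

  -- Vertices below `k` form the path with root 0, and every later vertex `u` is a leaf attached to
  -- path vertex `u % k`; the remainder is thus the index on the path for both kinds.
  position : Fin n → ℕ
  position u = toℕ u % k

  position-path : ∀ {u} → toℕ u < k → position u ≡ toℕ u
  position-path = m<n⇒m%n≡m

  parentℕ : ℕ → ℕ
  parentℕ u = if u <ᵇ k then pred u else u % k

  parent : ℕ → Maybe (Fin n)
  parent zero    = nothing
  parent (suc u) = just (vertex (parentℕ (suc u)))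

  parentℕ-path : ∀ {u} → u < k → parentℕ u ≡ pred u
  parentℕ-path {u} u<k with u <ᵇ k | <⇒<ᵇ u<k
  ... | true | _ = refl

  parentℕ-leaf : ∀ {u} → k ≤ u → parentℕ u ≡ u % k
  parentℕ-leaf {u} k≤u with u <ᵇ k | <ᵇ⇒< u k
  ... | false | _   = refl
  ... | true  | u<k = contradiction (u<k _) (≤⇒≯ k≤u)

  -- Hence positions never increase on the way to the root, which `below⁻¹` relies on.
  parentℕ≤% : ∀ u → parentℕ u ≤ u % k
  parentℕ≤% u with u <? k
  ... | yes u<k rewrite parentℕ-path u<k | m<n⇒m%n≡m u<k = pred[n]≤n
  ... | no  u≮k = ≤-reflexive (parentℕ-leaf (≮⇒≥ u≮k))

  parentℕ<k : ∀ u → parentℕ u < k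
  parentℕ<k u = ≤-<-trans (parentℕ≤% u) (m%n<n u k)

  parentℕ-< : ∀ u → parentℕ (suc u) < suc u
  parentℕ-< u with suc u <? k
  ... | yes u<k = ≤-reflexive (cong suc (parentℕ-path u<k))
  ... | no  u≮k = <-≤-trans (parentℕ<k (suc u)) (≮⇒≥ u≮k)

  toℕ-parent : ∀ u {p} → parent u ≡ just p → toℕ p ≡ parentℕ u
  toℕ-parent (suc u) refl = toℕ-vertex (<-≤-trans (parentℕ<k (suc u)) k≤n)

  parent-< : ∀ u {p} → parent u ≡ just p → toℕ p < u
  parent-< (suc u) same = subst (_< suc u) (sym (toℕ-parent (suc u) same)) (parentℕ-< u)

  parent⁺-< : ∀ {u v} → TransClosure (Edge (tabulate (parent ∘ toℕ))) u v → toℕ v < toℕ u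
  parent⁺-< {u} [ e ]   = parent-< (toℕ u) (trans (sym (lookup∘tabulate _ u)) e)
  parent⁺-< {u} (e ∷ p) = <-trans (parent⁺-< p) (parent-< (toℕ u) (trans (sym (lookup∘tabulate _ u)) e))

  caterpillar : Forest n
  caterpillar = record
    { parents = tabulate (parent ∘ toℕ)
    ; acyclic = λ v p → <-irrefl refl (parent⁺-< p)
    }

  pruned : List (Fin n) → Forest n
  pruned []      = caterpillar
  pruned (c ∷ C) = deleteParentEdge (pruned C) c

  pruned-∉ : ∀ {C u} → u ∉ C → lookup (parents (pruned C)) u ≡ parent (toℕ u)
  pruned-∉ {[]}    {u} _   = lookup∘tabulate _ u
  pruned-∉ {c ∷ C} {u} u∉C =
    trans (lookup∘update′ (λ u≡c → u∉C (here u≡c)) (parents (pruned C)) nothing) (pruned-∉ (u∉C ∘ there))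

  pruned-∈ : ∀ {C u} → u ∈ C → lookup (parents (pruned C)) u ≡ nothing
  pruned-∈ {c ∷ C} {u} u∈C with u Fin.≟ c | u∈C
  ... | yes refl | _         = lookup∘update u (parents (pruned C)) nothing
  ... | no u≢c   | here u≡c  = contradiction u≡c u≢c
  ... | no u≢c   | there u∈C = trans (lookup∘update′ u≢c (parents (pruned C)) nothing) (pruned-∈ u∈C)

  edge-∉ : ∀ {C u p} → Edge (parents (pruned C)) u p → u ∉ C
  edge-∉ e u∈C with () ← trans (sym e) (pruned-∈ u∈C)

  IsLeaf : Fin n → Set
  IsLeaf u = k ≤ toℕ u

  leaf-edge : ∀ {C u} → IsLeaf u → u ∉ C → Edge (parents (pruned C)) u (vertex (position u))
  leaf-edge {u = u} leaf u∉C with toℕ u | pruned-∉ u∉C | leaf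
  ... | zero  | _    | k≤0 = contradiction (n≤0⇒n≡0 k≤0) (≢-nonZero⁻¹ k)
  ... | suc u | same | k≤u = trans same (cong (just ∘ vertex) (parentℕ-leaf k≤u))

  module _ {C : List (Fin n)} (leaves : All IsLeaf C) {i : ℕ} (i<k : i < k) where

    private
      E : Fin n → Fin n → Set
      E = Edge (parents (pruned C))

    path-∉ : ∀ {j} → j < k → vertex j ∉ C
    path-∉ j<k j∈C = ≤⇒≯ (All.lookup leaves j∈C) (subst (_< k) (sym (toℕ-vertex (<-≤-trans j<k k≤n))) j<k)

    below-path : ∀ j → j < k → i ≤ j → Star E (vertex j) (vertex i)
    below-path j j<k i≤j with m≤n⇒m<n∨m≡n i≤j
    below-path j       j<k i≤j | inj₂ refl = ε
    below-path (suc j) j<k i≤j | inj₁ i<j  = edge ◅ below-path j (<⇒≤ j<k) (≤-pred i<j)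
      where
      edge : E (vertex (suc j)) (vertex j)
      edge = trans (pruned-∉ (path-∉ j<k))
        (trans (cong parent (toℕ-vertex (<-≤-trans j<k k≤n))) (cong (just ∘ vertex) (parentℕ-path j<k)))

    -- Only leaves are cut, so the first edge is the only one on the way from `u` to `vertex i` that
    -- could be missing.
    below : ∀ {u} → u ∉ C → i ≤ position u → Star E u (vertex i)
    below {u} u∉C i≤ with toℕ u <? k
    ... | yes u<k = subst (λ u → Star E u (vertex i)) (vertex-toℕ u)
                      (below-path (toℕ u) u<k (subst (i ≤_) (position-path u<k) i≤))
    ... | no  u≮k = leaf-edge (≮⇒≥ u≮k) u∉C ◅ below-path (position u) (m%n<n (toℕ u) k) i≤

    below⁻¹ : ∀ {u} → Star E u (vertex i) → u ∉ C × i ≤ position u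
    below⁻¹ ε = path-∉ i<k , ≤-reflexive (sym (trans (position-path {vertex i} (subst (_< k) (sym toℕ≡i) i<k)) toℕ≡i))
      where
      toℕ≡i : toℕ (vertex i) ≡ i
      toℕ≡i = toℕ-vertex (<-≤-trans i<k k≤n)
    below⁻¹ {u} (_◅_ {j = p} e p→i) = edge-∉ e , (begin
      i                ≤⟨ proj₂ (below⁻¹ p→i) ⟩
      toℕ p % k        ≡⟨ cong (_% k) p≡ ⟩
      parentℕ (toℕ u) % k ≡⟨ m<n⇒m%n≡m (parentℕ<k (toℕ u)) ⟩
      parentℕ (toℕ u)  ≤⟨ parentℕ≤% (toℕ u) ⟩
      position u       ∎)
      where
      open ≤-Reasoning
      p≡ : toℕ p ≡ parentℕ (toℕ u)
      p≡ = toℕ-parent (toℕ u) (trans (sym (pruned-∉ {C} (edge-∉ e))) e)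

  -- Distinct weights: the weight of a cut leaf identifies the leaf.
  weight : Weights n
  weight u = + toℕ u

  weightFrom : ℕ → Fin n → ℕ
  weightFrom i u = if i ≤ᵇ position u then toℕ u else 0

  removed : List (Fin n) → ℕ → ℕ
  removed C i = listSum (map (weightFrom i) C)

  totalFrom : ℕ → ℤ
  totalFrom i = sum (λ u → + weightFrom i u)

  -- The total does not depend on the cuts, so comparing two answers at `i` amounts to comparing the
  -- natural numbers `removed C i`.
  suffixSum : List (Fin n) → ℕ → ℤ
  suffixSum C i = totalFrom i ℤ.- + removed C i

  private
    kept : List (Fin n) → ℕ → Fin n → ℤ
    kept C i u = if does (u ∈? C) then 0ℤ else + weightFrom i u

    kept-∈ : ∀ {C i u} → u ∈ C → kept C i u ≡ 0ℤ
    kept-∈ {C} {u = u} u∈C with u ∈? C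
    ... | yes _  = refl
    ... | no u∉C = contradiction u∈C u∉C

    kept-∉ : ∀ {C i u} → u ∉ C → kept C i u ≡ + weightFrom i u
    kept-∉ {C} {u = u} u∉C with u ∈? C
    ... | yes u∈C = contradiction u∈C u∉C
    ... | no _    = refl

    kept-∷ : ∀ {C i} c u → u ≢ c → kept C i u ≡ kept (c ∷ C) i u
    kept-∷ {C} {i} c u u≢c with u Fin.≟ c
    ... | yes u≡c = contradiction u≡c u≢c
    ... | no  _   = refl

  -- Each cut moves one term from the kept to the removed side; uniqueness prevents a leaf from
  -- being moved twice.
  sum-kept : ∀ {C} i → Unique C → sum (kept C i) ℤ.+ + removed C i ≡ totalFrom i
  sum-kept {[]}    i _            = ℤ.+-identityʳ _
  sum-kept {c ∷ C} i (c∉C ∷ uniq) = begin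
    sum (kept (c ∷ C) i) ℤ.+ (+ weightFrom i c ℤ.+ + removed C i)
      ≡⟨ ℤ.+-assoc (sum (kept (c ∷ C) i)) _ _ ⟨
    sum (kept (c ∷ C) i) ℤ.+ + weightFrom i c ℤ.+ + removed C i
      ≡⟨ cong (λ z → sum (kept (c ∷ C) i) ℤ.+ z ℤ.+ + removed C i) (kept-∉ {C} {i} (λ c∈C → All.lookup c∉C c∈C refl)) ⟨
    sum (kept (c ∷ C) i) ℤ.+ kept C i c ℤ.+ + removed C i
      ≡⟨ cong (ℤ._+ + removed C i) (sum-remove (kept C i) (kept (c ∷ C) i) c
           (kept-∷ {C} {i} c) (kept-∈ {c ∷ C} {i} (here refl))) ⟩
    sum (kept C i) ℤ.+ + removed C i
      ≡⟨ sum-kept i uniq ⟩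
    totalFrom i ∎
    where open ≡-Reasoning

  below-subset : List (Fin n) → ℕ → Subset n
  below-subset C i = tabulate λ u → (i ≤ᵇ position u) ∧ not (does (u ∈? C))

  subtreeSum-pruned : ∀ {C} → Unique C → All IsLeaf C → ∀ {i} → i < k →
    SubtreeSum (pruned C) weight (vertex i) (suffixSum C i)
  subtreeSum-pruned {C} uniq leaves {i} i<k =
    below-subset C i , (λ u → mk⇔ (to u) (from u)) , (begin
    totalFrom i ℤ.- + removed C i
      ≡⟨ cong (ℤ._- + removed C i) (sum-kept i uniq) ⟨
    sum (kept C i) ℤ.+ + removed C i ℤ.- + removed C i
      ≡⟨ ℤ.+-assoc (sum (kept C i)) _ _ ⟩
    sum (kept C i) ℤ.+ (+ removed C i ℤ.- + removed C i)
      ≡⟨ cong (ℤ._+_ (sum (kept C i))) (ℤ.+-inverseʳ (+ removed C i)) ⟩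
    sum (kept C i) ℤ.+ 0ℤ
      ≡⟨ ℤ.+-identityʳ _ ⟩
    sum (kept C i)
      ≡⟨ sum-cong-≗ pointwise ⟩
    sum (λ u → if lookup (below-subset C i) u then weight u else 0ℤ) ∎)
    where
    open ≡-Reasoning
    pointwise : ∀ u → kept C i u ≡ (if lookup (below-subset C i) u then weight u else 0ℤ)
    pointwise u rewrite lookup∘tabulate (λ u → (i ≤ᵇ position u) ∧ not (does (u ∈? C))) u
      with i ≤ᵇ position u | does (u ∈? C)
    ... | true  | true  = refl
    ... | true  | false = refl
    ... | false | true  = refl
    ... | false | false = refl
    to : ∀ u → u ∈ₛ below-subset C i → Descendant (pruned C) (vertex i) u
    to u u∈S with i ≤ᵇ position u | ≤ᵇ⇒≤ i (position u) | u ∈? C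
                | trans (sym (lookup∘tabulate (λ u → (i ≤ᵇ position u) ∧ not (does (u ∈? C))) u)) ([]=⇒lookup u∈S)
    ... | true | i≤ | no u∉C | _ = below leaves i<k u∉C (i≤ _)
    from : ∀ u → Descendant (pruned C) (vertex i) u → u ∈ₛ below-subset C i
    from u d with u∉C , i≤ ← below⁻¹ leaves i<k d
      = lookup⇒[]= u _ (trans (lookup∘tabulate _ u) member)
      where
      member : (i ≤ᵇ position u) ∧ not (does (u ∈? C)) ≡ true
      member with i ≤ᵇ position u | ≤⇒≤ᵇ i≤ | u ∈? C
      ... | true | _ | yes u∈C = contradiction u∈C u∉C
      ... | true | _ | no  _   = refl

-- Splitting by parity, and sums over initial and final segments

++-splitˡ : ∀ (xs xs′ : List A) {ys ys′} → length xs ≡ length xs′ → xs ++ ys ≡ xs′ ++ ys′ →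
            xs ≡ xs′ × ys ≡ ys′
++-splitˡ []       []         _   same = refl , same
++-splitˡ (x ∷ xs) (x′ ∷ xs′) len same
  with refl , same′ ← ∷-injective same
  with refl , same″ ← ++-splitˡ xs xs′ (suc-injective len) same′ = refl , same″

even-or-odd : ∀ p → ∃[ q ] (p ≡ 2 * q ⊎ p ≡ 1 + 2 * q)
even-or-odd zero    = 0 , inj₁ refl
even-or-odd (suc p) with even-or-odd p
... | q , inj₁ refl = q , inj₂ refl
... | q , inj₂ refl = suc q , inj₁ (sym (*-suc 2 q))

halve : ∀ {p N} → p < 2 * N → ∃[ q ] (q < N × (p ≡ 2 * q ⊎ p ≡ 1 + 2 * q))
halve {p} {N} p<2N with even-or-odd p
... | q , inj₁ refl = q , *-cancelˡ-< 2 q N p<2N , inj₁ refl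
... | q , inj₂ refl = q , *-cancelˡ-< 2 q N (<⇒≤ p<2N) , inj₂ refl

even<2N : ∀ {q N} → q < N → 2 * q < 2 * N
even<2N = *-monoʳ-< 2

odd<2N : ∀ {q N} → q < N → 1 + 2 * q < 2 * N
odd<2N {q} {N} q<N = ≤-trans (≤-reflexive (sym (*-suc 2 q))) (*-monoʳ-≤ 2 q<N)

interleave : (ℕ → A) → (ℕ → A) → ℕ → A
interleave f g zero          = f 0
interleave f g (suc zero)    = g 0
interleave f g (suc (suc p)) = interleave (f ∘ suc) (g ∘ suc) p

interleave-even : ∀ (f g : ℕ → A) q → interleave f g (2 * q) ≡ f q
interleave-even f g zero    = refl
interleave-even f g (suc q) = trans (cong (interleave f g) (*-suc 2 q)) (interleave-even (f ∘ suc) (g ∘ suc) q)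

interleave-odd : ∀ (f g : ℕ → A) q → interleave f g (1 + 2 * q) ≡ g q
interleave-odd f g zero    = refl
interleave-odd f g (suc q) = trans (cong (interleave f g ∘ suc) (*-suc 2 q)) (interleave-odd (f ∘ suc) (g ∘ suc) q)

Σ< : ℕ → (ℕ → ℕ) → ℕ
Σ< zero    f = 0
Σ< (suc N) f = f 0 + Σ< N (f ∘ suc)

Σ<-cong : ∀ N {f g} → (∀ {p} → p < N → f p ≡ g p) → Σ< N f ≡ Σ< N g
Σ<-cong zero    f≗g = refl
Σ<-cong (suc N) f≗g = cong₂ _+_ (f≗g z<s) (Σ<-cong N (f≗g ∘ s<s))

Σ<-halves : ∀ N f → Σ< (2 * N) f ≡ Σ< N (λ q → f (2 * q)) + Σ< N (λ q → f (1 + 2 * q))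
Σ<-halves zero    f = refl
Σ<-halves (suc N) f = begin
  Σ< (2 * suc N) f
    ≡⟨ cong (λ m → Σ< m f) (*-suc 2 N) ⟩
  f 0 + (f 1 + Σ< (2 * N) (λ p → f (2 + p)))
    ≡⟨ cong (λ z → f 0 + (f 1 + z)) (Σ<-halves N (λ p → f (2 + p))) ⟩
  f 0 + (f 1 + (Σ< N (λ q → f (2 + 2 * q)) + Σ< N (λ q → f (3 + 2 * q))))
    ≡⟨ shuffle (f 0) (f 1) _ _ ⟩
  f 0 + Σ< N (λ q → f (2 + 2 * q)) + (f 1 + Σ< N (λ q → f (3 + 2 * q)))
    ≡⟨ cong₂ (λ y z → f 0 + y + (f 1 + z))
         (Σ<-cong N λ {q} _ → cong f (sym (*-suc 2 q))) (Σ<-cong N λ {q} _ → cong (f ∘ suc) (sym (*-suc 2 q))) ⟩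
  f 0 + Σ< N (λ q → f (2 * suc q)) + (f 1 + Σ< N (λ q → f (1 + 2 * suc q))) ∎
  where
  open ≡-Reasoning
  shuffle : ∀ a b c d → a + (b + (c + d)) ≡ a + c + (b + d)
  shuffle = solve-∀

Σ≥ : ℕ → ℕ → (ℕ → ℕ) → ℕ
Σ≥ zero    N       f = Σ< N f
Σ≥ (suc m) zero    f = 0
Σ≥ (suc m) (suc N) f = Σ≥ m N (f ∘ suc)

Σ<≡Σ≥ : ∀ m N {f g} → (∀ {p} → p < N → m ≤ p → f p ≡ g p) → (∀ {p} → p < N → p < m → f p ≡ 0) →
        Σ< N f ≡ Σ≥ m N g
Σ<≡Σ≥ zero    N       on off = Σ<-cong N λ p<N → on p<N z≤n
Σ<≡Σ≥ (suc m) zero    on off = refl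
Σ<≡Σ≥ (suc m) (suc N) on off =
  cong₂ _+_ (off z<s z<s) (Σ<≡Σ≥ m N (λ p<N m≤p → on (s<s p<N) (s≤s m≤p)) (λ p<N p<m → off (s<s p<N) (s<s p<m)))

-- A triangular system: the tail sums from `1` on recover all later terms, and cancelling these in
-- the full sum leaves the first term.
Σ≥-injective : ∀ N {f g} → (∀ {m} → m < N → Σ≥ m N f ≡ Σ≥ m N g) → ∀ {p} → p < N → f p ≡ g p
Σ≥-injective (suc N) {f} {g} same {zero}  _ =
  +-cancelʳ-≡ (Σ< N (f ∘ suc)) (f 0) (g 0) $
    trans (same z<s) (cong (λ z → g 0 + z) (sym (Σ<-cong N (Σ≥-injective N (same ∘ s<s)))))
Σ≥-injective (suc N)         same {suc p} p<N = Σ≥-injective N (same ∘ s<s) (≤-pred p<N)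

-- The schedule of one round

-- A perfect binary tree. In `x₁ ∥ x₀` the left half is visited first; the subscripts used
-- throughout are the parities of the positions, so the odd positions come before the even ones.
data Choices (K : ℕ) : ℕ → Set where
  choice : Fin K → Choices K 0
  _∥_    : ∀ {l} → Choices K l → Choices K l → Choices K (suc l)

module _ {K : ℕ} where

  -- The index is the position, not the time of the visit: interleaving the halves undoes the bit
  -- reversal.
  at : ∀ {l} → Choices K l → ℕ → Fin K
  at (choice j) _ = j
  at (x₁ ∥ x₀)    = interleave (at x₀) (at x₁)

  at-injective : ∀ {l} {x y : Choices K l} → (∀ {p} → p < 2 ^ l → at x p ≡ at y p) → x ≡ y
  at-injective {x = choice _} {choice _} same = cong choice (same z<s)
  at-injective {x = x₁ ∥ x₀}  {y₁ ∥ y₀}  same = cong₂ _∥_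
    (at-injective λ {q} q< → trans (sym (interleave-odd (at x₀) (at x₁) q))
                            (trans (same (odd<2N q<)) (interleave-odd (at y₀) (at y₁) q)))
    (at-injective λ {q} q< → trans (sym (interleave-even (at x₀) (at x₁) q))
                            (trans (same (even<2N q<)) (interleave-even (at y₀) (at y₁) q)))

zeroth-position : ∀ o s → o + s * 0 ≡ o
zeroth-position = solve-∀

even-position : ∀ o s q → o + s * (2 * q) ≡ o + 2 * s * q
even-position = solve-∀

odd-position : ∀ o s q → o + s * (1 + 2 * q) ≡ o + s + 2 * s * q
odd-position = solve-∀

module Schedule (n k : ℕ) .{{_ : NonZero n}} .{{_ : NonZero k}} (k≤n : k ≤ n) (K : ℕ) where

  open Caterpillar n k k≤n

  -- `slot i j` is the leaf that choice `j` cuts when position `i` is visited. The assignment is a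
  -- parameter because it changes between rounds.
  record Slots : Set where
    field
      slot      : ℕ → Fin K → Fin n
      slot-pos  : ∀ {i} → i < k → ∀ j → position (slot i j) ≡ i
      slot-leaf : ∀ {i} → i < k → ∀ j → IsLeaf (slot i j)
      slot-inj  : ∀ {i} → i < k → ∀ {j j′} → slot i j ≡ slot i j′ → j ≡ j′

  removed-++ : ∀ C D i → removed (C ++ D) i ≡ removed C i + removed D i
  removed-++ C D i =
    trans (cong listSum (map-++ (weightFrom i) C D)) (listSum-++ (map (weightFrom i) C) _)

  weightFrom-≤ : ∀ {i u} → i ≤ position u → weightFrom i u ≡ toℕ u
  weightFrom-≤ {i} {u} i≤ with i ≤ᵇ position u | ≤⇒≤ᵇ i≤
  ... | true | _ = refl

  weightFrom-> : ∀ {i u} → position u < i → weightFrom i u ≡ 0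
  weightFrom-> {i} {u} >i with i ≤ᵇ position u | ≤ᵇ⇒≤ i (position u)
  ... | false | _  = refl
  ... | true  | i≤ = contradiction (i≤ _) (<⇒≱ >i)

  suffixSum-removed : ∀ C D i → suffixSum C i ≡ suffixSum D i → removed C i ≡ removed D i
  suffixSum-removed C D i same =
    ℤ.+-injective (ℤ.neg-injective
      (∙-cancelˡ ℤ.+-0-abelianGroup (totalFrom i) (ℤ.- + removed C i) (ℤ.- + removed D i) same))

  InRange : ℕ → ℕ → ℕ → Set
  InRange l o s = ∀ {p} → p < 2 ^ l → o + s * p < k

  inRange-odd : ∀ l o s → InRange (suc l) o s → InRange l (o + s) (2 * s)
  inRange-odd l o s r {q} q< = subst (_< k) (odd-position o s q) (r (odd<2N q<))

  inRange-even : ∀ l o s → InRange (suc l) o s → InRange l o (2 * s)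
  inRange-even l o s r {q} q< = subst (_< k) (even-position o s q) (r (even<2N q<))

  module _ (Σₛ : Slots) where
    open Slots Σₛ

    -- The positions o, o + s, …, o + (2 ^ l - 1) s are visited in bit-reversal order;
    -- the latest cut is listed first.
    cuts : ∀ {l} (o s : ℕ) → Choices K l → List (Fin n)
    cuts o s (choice j) = slot o j ∷ []
    cuts o s (x₁ ∥ x₀)  = cuts o (2 * s) x₀ ++ cuts (o + s) (2 * s) x₁

    ops : ∀ {l} (o s : ℕ) → Choices K l → List (Operation n)
    ops o s (choice j) = cut (slot o j) ∷ subtree-sum (vertex o) ∷ []
    ops o s (x₁ ∥ x₀)  = ops (o + s) (2 * s) x₁ ++ ops o (2 * s) x₀

    answers : ∀ {l} (o s : ℕ) → Choices K l → List (Fin n) → List ℤ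
    answers o s (choice j) C = suffixSum (slot o j ∷ C) o ∷ []
    answers o s (x₁ ∥ x₀)  C =
      answers (o + s) (2 * s) x₁ C ++ answers o (2 * s) x₀ (cuts (o + s) (2 * s) x₁ ++ C)

    length-ops : ∀ {l} o s (x : Choices K l) → length (ops o s x) ≡ 2 * 2 ^ l
    length-ops o s (choice j) = refl
    length-ops {suc l} o s (x₁ ∥ x₀) = begin
      length (ops (o + s) (2 * s) x₁ ++ ops o (2 * s) x₀)
        ≡⟨ length-++ (ops (o + s) (2 * s) x₁) ⟩
      length (ops (o + s) (2 * s) x₁) + length (ops o (2 * s) x₀)
        ≡⟨ cong₂ _+_ (length-ops (o + s) (2 * s) x₁) (length-ops o (2 * s) x₀) ⟩
      2 * 2 ^ l + 2 * 2 ^ l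
        ≡⟨ double (2 ^ l) ⟩
      2 * 2 ^ suc l ∎
      where
      open ≡-Reasoning
      double : ∀ m → 2 * m + 2 * m ≡ 2 * (2 * m)
      double = solve-∀

    length-answers : ∀ {l} o s (x : Choices K l) C D → length (answers o s x C) ≡ length (answers o s x D)
    length-answers o s (choice j) C D = refl
    length-answers o s (x₁ ∥ x₀)  C D =
      trans (length-++ (answers (o + s) (2 * s) x₁ C))
        (trans (cong₂ _+_ (length-answers (o + s) (2 * s) x₁ C D) (length-answers o (2 * s) x₀ _ _))
          (sym (length-++ (answers (o + s) (2 * s) x₁ D))))

    ∈-cuts : ∀ {l} o s (x : Choices K l) {c} → c ∈ cuts o s x →
             ∃[ p ] (p < 2 ^ l × c ≡ slot (o + s * p) (at x p))
    ∈-cuts o s (choice j) (here refl) =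
      0 , z<s , cong (λ i → slot i j) (sym (zeroth-position o s))
    ∈-cuts o s (x₁ ∥ x₀) c∈ with ∈-++⁻ (cuts o (2 * s) x₀) c∈
    ... | inj₁ c∈₀ with q , q< , refl ← ∈-cuts o (2 * s) x₀ c∈₀
      = 2 * q , even<2N q< , cong₂ slot (sym (even-position o s q)) (sym (interleave-even (at x₀) (at x₁) q))
    ... | inj₂ c∈₁ with q , q< , refl ← ∈-cuts (o + s) (2 * s) x₁ c∈₁
      = 1 + 2 * q , odd<2N q< , cong₂ slot (sym (odd-position o s q)) (sym (interleave-odd (at x₀) (at x₁) q))

    -- Bit reversal only permutes the cuts, so their weight can be summed in order of position.
    removed-cuts : ∀ {l} o s (x : Choices K l) i →
      removed (cuts o s x) i ≡ Σ< (2 ^ l) (λ p → weightFrom i (slot (o + s * p) (at x p)))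
    removed-cuts o s (choice j) i =
      cong (λ o → weightFrom i (slot o j) + 0) (sym (zeroth-position o s))
    removed-cuts {suc l} o s (x₁ ∥ x₀) i = begin
      removed (cuts o (2 * s) x₀ ++ cuts (o + s) (2 * s) x₁) i
        ≡⟨ removed-++ (cuts o (2 * s) x₀) _ i ⟩
      removed (cuts o (2 * s) x₀) i + removed (cuts (o + s) (2 * s) x₁) i
        ≡⟨ cong₂ _+_ (removed-cuts o (2 * s) x₀ i) (removed-cuts (o + s) (2 * s) x₁ i) ⟩
      Σ< (2 ^ l) (λ q → weightFrom i (slot (o + 2 * s * q) (at x₀ q))) +
      Σ< (2 ^ l) (λ q → weightFrom i (slot (o + s + 2 * s * q) (at x₁ q)))
        ≡⟨ cong₂ _+_
             (Σ<-cong (2 ^ l) λ {q} _ → cong (weightFrom i)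
               (cong₂ slot (sym (even-position o s q)) (sym (interleave-even (at x₀) (at x₁) q))))
             (Σ<-cong (2 ^ l) λ {q} _ → cong (weightFrom i)
               (cong₂ slot (sym (odd-position o s q)) (sym (interleave-odd (at x₀) (at x₁) q)))) ⟩
      Σ< (2 ^ l) (λ q → f (2 * q)) + Σ< (2 ^ l) (λ q → f (1 + 2 * q))
        ≡⟨ Σ<-halves (2 ^ l) f ⟨
      Σ< (2 * 2 ^ l) f ∎
      where
      open ≡-Reasoning
      f : ℕ → ℕ
      f p = weightFrom i (slot (o + s * p) (at (x₁ ∥ x₀) p))

    -- The cuts made within `x` are common to both answer lists and cancel, which leaves the
    -- contributions of the earlier cuts `C` and `D`.
    answers-determine-removed : ∀ {l} o s (x : Choices K l) {C D} →
      answers o s x C ≡ answers o s x D →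
      ∀ {p} → p < 2 ^ l → removed C (o + s * p) ≡ removed D (o + s * p)
    answers-determine-removed o s (choice j) {C} {D} same {zero} _ =
      subst (λ i → removed C i ≡ removed D i) (sym (zeroth-position o s))
        (+-cancelˡ-≡ (weightFrom o (slot o j)) _ _
          (suffixSum-removed (slot o j ∷ C) (slot o j ∷ D) o (proj₁ (∷-injective same))))
    answers-determine-removed o s (choice j) same {suc p} (s≤s ())
    answers-determine-removed {suc l} o s (x₁ ∥ x₀) {C} {D} same {p} p<
      with same₁ , same₀ ← ++-splitˡ (answers (o + s) (2 * s) x₁ C) (answers (o + s) (2 * s) x₁ D)
                             (length-answers (o + s) (2 * s) x₁ C D) same
      with halve {p} {2 ^ l} p<
    ... | q , q< , inj₁ refl = subst (λ i → removed C i ≡ removed D i) (sym (even-position o s q))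
      (+-cancelˡ-≡ (removed cuts₁ i) _ _
        (trans (sym (removed-++ cuts₁ C i))
          (trans (answers-determine-removed o (2 * s) x₀ same₀ q<) (removed-++ cuts₁ D i))))
      where
      cuts₁ = cuts (o + s) (2 * s) x₁
      i = o + 2 * s * q
    ... | q , q< , inj₂ refl = subst (λ i → removed C i ≡ removed D i) (sym (odd-position o s q))
      (answers-determine-removed (o + s) (2 * s) x₁ same₁ q<)

    -- The queries of the second half separate the cuts of the first half,
    -- since there is a query position just below each cut position.
    first-half-determined : ∀ {l} o s .{{_ : NonZero s}} → InRange (suc l) o s →
      (x y : Choices K l) (z : Choices K l) (C : List (Fin n)) →
      answers o (2 * s) z (cuts (o + s) (2 * s) x ++ C) ≡ answers o (2 * s) z (cuts (o + s) (2 * s) y ++ C) →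
      x ≡ y
    first-half-determined {l} o s range x y z C same =
      -- Equal tail sums give equal vertex numbers at each cut position, hence equal leaves, hence
      -- equal choices.
      at-injective λ {p} p< → slot-inj (inRange-odd l o s range p<)
        (Fin.toℕ-injective (Σ≥-injective (2 ^ l) suffixes p<))
      where
      r : ℕ → ℕ
      r p = o + s + 2 * s * p

      -- The query position `o + 2 * s * m` lies `s` below the cut position `r m` and, for positive
      -- `m`, `s` above the previous one, so exactly the cuts from index `m` on count.
      weights : ∀ (x : Choices K l) m → removed (cuts (o + s) (2 * s) x) (o + 2 * s * m) ≡
                Σ≥ m (2 ^ l) (λ p → toℕ (slot (r p) (at x p)))
      weights x m = trans (removed-cuts (o + s) (2 * s) x (o + 2 * s * m))
        (Σ<≡Σ≥ m (2 ^ l)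
          (λ {p} p< m≤p → weightFrom-≤ {o + 2 * s * m} (begin
            o + 2 * s * m      ≤⟨ +-monoʳ-≤ o (*-monoʳ-≤ (2 * s) m≤p) ⟩
            o + 2 * s * p      ≤⟨ +-monoˡ-≤ (2 * s * p) (m≤m+n o s) ⟩
            o + s + 2 * s * p  ≡⟨ slot-pos (inRange-odd l o s range p<) _ ⟨
            _                  ∎))
          (λ {p} p< p<m → weightFrom-> {o + 2 * s * m} (begin-strict
            _                  ≡⟨ slot-pos (inRange-odd l o s range p<) _ ⟩
            o + s + 2 * s * p  <⟨ +-monoˡ-< (2 * s * p) (+-monoʳ-< o (m<m+n s (>-nonZero⁻¹ s))) ⟩
            o + (s + s) + 2 * s * p ≡⟨ next o s p ⟩
            o + 2 * s * suc p  ≤⟨ +-monoʳ-≤ o (*-monoʳ-≤ (2 * s) p<m) ⟩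
            o + 2 * s * m      ∎)))
        where
        open ≤-Reasoning
        next : ∀ o s p → o + (s + s) + 2 * s * p ≡ o + 2 * s * suc p
        next = solve-∀

      suffixes : ∀ {m} → m < 2 ^ l →
        Σ≥ m (2 ^ l) (λ p → toℕ (slot (r p) (at x p))) ≡ Σ≥ m (2 ^ l) (λ p → toℕ (slot (r p) (at y p)))
      suffixes {m} m< = trans (sym (weights x m)) (trans
        (+-cancelʳ-≡ (removed C i) _ _
          (trans (sym (removed-++ (cuts (o + s) (2 * s) x) C i))
            (trans (answers-determine-removed o (2 * s) z same m<)
              (removed-++ (cuts (o + s) (2 * s) y) C i))))
        (weights y m))
        where i = o + 2 * s * m

    -- All candidates at the coming positions are still attached, which makes the operations legal
    -- for every `x` alike.
    record Ready (l o s : ℕ) (C : List (Fin n)) : Set where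
      field
        unique    : Unique C
        leaves    : All IsLeaf C
        inRange   : InRange l o s
        available : ∀ {p} → p < 2 ^ l → ∀ j → slot (o + s * p) j ∉ C

    open Ready

    ready-odd : ∀ {l o s C} → Ready (suc l) o s C → Ready l (o + s) (2 * s) C
    ready-odd {l} {o} {s} {C} R = record
      { unique    = unique R
      ; leaves    = leaves R
      ; inRange   = inRange-odd l o s (inRange R)
      ; available = λ {q} q< j → subst (λ i → slot i j ∉ C) (odd-position o s q) (available R (odd<2N q<) j)
      }

    cuts-leaves : ∀ {l o s C} → Ready l o s C → (x : Choices K l) → All IsLeaf (cuts o s x ++ C)
    cuts-leaves {o = o} {s} R x = All.++⁺ (All.tabulate leaf) (leaves R)
      where
      leaf : ∀ {c} → c ∈ cuts o s x → IsLeaf c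
      leaf c∈ with p , p< , refl ← ∈-cuts o s x c∈ = slot-leaf (inRange R p<) _

    mutual

      cuts-unique : ∀ {l o s C} .{{_ : NonZero s}} → Ready l o s C → (x : Choices K l) → Unique (cuts o s x ++ C)
      cuts-unique {o = o} {s} {C} R (choice j) =
        All.tabulate (λ { c∈C refl →
          available R z<s j (subst (λ i → slot i j ∈ C) (sym (zeroth-position o s)) c∈C) })
        ∷ unique R
      cuts-unique {o = o} {s} {C} R (x₁ ∥ x₀) =
        subst Unique (sym (++-assoc (cuts o (2 * s) x₀) (cuts (o + s) (2 * s) x₁) C))
          (cuts-unique {{m*n≢0 2 s}} (ready-even R x₁) x₀)

      ready-even : ∀ {l o s C} .{{_ : NonZero s}} → Ready (suc l) o s C → (x₁ : Choices K l) →
                   Ready l o (2 * s) (cuts (o + s) (2 * s) x₁ ++ C)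
      ready-even {l} {o} {s} {C} R x₁ = record
        { unique    = cuts-unique {{m*n≢0 2 s}} (ready-odd R) x₁
        ; leaves    = cuts-leaves (ready-odd R) x₁
        ; inRange   = inRange-even l o s (inRange R)
        ; available = avail
        }
        where
        avail : ∀ {q} → q < 2 ^ l → ∀ j → slot (o + 2 * s * q) j ∉ cuts (o + s) (2 * s) x₁ ++ C
        avail {q} q< j c∈ with ∈-++⁻ (cuts (o + s) (2 * s) x₁) c∈
        ... | inj₂ c∈C = available R (even<2N q<) j (subst (λ i → slot i j ∈ C) (sym (even-position o s q)) c∈C)
        -- A common leaf would put one position at both an even and an odd multiple of `s` above
        -- `o`.
        ... | inj₁ c∈₁ with p , p< , same ← ∈-cuts (o + s) (2 * s) x₁ c∈₁
          = even≢odd q p (*-cancelˡ-≡ (2 * q) (1 + 2 * p) s (+-cancelˡ-≡ o _ _ (begin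
              o + s * (2 * q)                             ≡⟨ even-position o s q ⟩
              o + 2 * s * q                               ≡⟨ slot-pos (inRange-even l o s (inRange R) q<) j ⟨
              position (slot (o + 2 * s * q) j)           ≡⟨ cong position same ⟩
              position (slot (o + s + 2 * s * p) (at x₁ p)) ≡⟨ slot-pos (inRange-odd l o s (inRange R) p<) _ ⟩
              o + s + 2 * s * p                           ≡⟨ odd-position o s p ⟨
              o + s * (1 + 2 * p)                         ∎)))
          where open ≡-Reasoning

    -- The history is prepended to an arbitrary continuation: this composes over the two halves and
    -- is the form that `Servable-advance` takes.
    history : ∀ {l o s C} .{{_ : NonZero s}} → Ready l o s C → (x : Choices K l) → ∀ {os as} →
      History weight (pruned (cuts o s x ++ C)) os as →
      History weight (pruned C) (ops o s x ++ os) (answers o s x C ++ as)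
    history {o = o} {s} {C} R (choice j) h =
      cut (leaf-edge (slot-leaf o<k j) c∉C)
        (subtree-sum (subtreeSum-pruned (cuts-unique R (choice j)) (cuts-leaves R (choice j)) o<k) h)
      where
      o≡ : o + s * 0 ≡ o
      o≡ = zeroth-position o s
      o<k : o < k
      o<k = subst (_< k) o≡ (inRange R z<s)
      c∉C : slot o j ∉ C
      c∉C = subst (λ i → slot i j ∉ C) o≡ (available R z<s j)
    history {o = o} {s} {C} R (x₁ ∥ x₀) {os} {as} h =
      subst₂ (History weight (pruned C))
        (sym (++-assoc (ops (o + s) (2 * s) x₁) (ops o (2 * s) x₀) os))
        (sym (++-assoc (answers (o + s) (2 * s) x₁ C) (answers o (2 * s) x₀ _) as))
        (history {{m*n≢0 2 s}} (ready-odd R) x₁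
          (history {{m*n≢0 2 s}} (ready-even R x₁) x₀
            (subst (λ C → History weight (pruned C) os as)
              (++-assoc (cuts o (2 * s) x₀) (cuts (o + s) (2 * s) x₁) C) h)))

-- Counting descriptions of the choices of a round

×-fin : A ↣ Fin a → B ↣ Fin b → (A × B) ↣ Fin (a * b)
×-fin f g = ↔⇒↣ (↔-sym Fin.*↔×) ↣-∘ (f ×-↣ g)

⊎-fin : A ↣ Fin a → B ↣ Fin b → (A ⊎ B) ↣ Fin (a + b)
⊎-fin f g = ↔⇒↣ (↔-sym Fin.+↔⊎) ↣-∘ (f ⊎-↣ g)

Vec-fin : ∀ r → A ↣ Fin a → Vec A r ↣ Fin (a ^ r)
Vec-fin zero    f = mk↣ {to = λ _ → zero} λ { {[]} {[]} _ → refl }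
Vec-fin (suc r) f = ×-fin f (Vec-fin r f) ↣-∘ mk↣ {to = λ { (x ∷ v) → x , v }} λ { {_ ∷ _} {_ ∷ _} refl → refl }

module _ (K : ℕ) where

  -- This is `K ^ (2 ^ l)`, in a form that follows the constructors of `Choices`.
  choiceCount : ℕ → ℕ
  choiceCount zero    = K
  choiceCount (suc l) = choiceCount l * choiceCount l

  choices-fin : ∀ l → Choices K l ↣ Fin (choiceCount l)
  choices-fin zero    = mk↣ {to = λ { (choice j) → j }} λ { {choice _} {choice _} refl → refl }
  choices-fin (suc l) = ×-fin (choices-fin l) (choices-fin l) ↣-∘
    mk↣ {to = λ { (x₁ ∥ x₀) → x₁ , x₀ }} λ { {_ ∥ _} {_ ∥ _} refl → refl }

  -- The opposite injection bounds the codes that contain choices; this one supplies the distinct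
  -- choices for the pigeonhole principle.
  fin-choices : ∀ l → Fin (choiceCount l) ↣ Choices K l
  fin-choices zero    = mk↣ {to = choice} λ { refl → refl }
  fin-choices (suc l) =
    mk↣ {to = λ { (x₁ , x₀) → x₁ ∥ x₀ }} (λ { {_ , _} {_ , _} refl → refl }) ↣-∘
    ((fin-choices l ×-↣ fin-choices l) ↣-∘ ↔⇒↣ Fin.*↔×)

-- Used to obtain either one costly choice or a code for every choice.
search : ∀ {m} {P Q : Fin m → Set} → (∀ i → P i ⊎ Q i) → ∃ P ⊎ (∀ i → Q i)
search {zero}  _      = inj₂ λ ()
search {suc m} decide with decide zero | search (decide ∘ suc)
... | inj₁ p | _            = inj₁ (zero , p)
... | inj₂ _ | inj₁ (i , p) = inj₁ (suc i , p)
... | inj₂ q | inj₂ qs      = inj₂ λ { zero → q ; (suc i) → qs i }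

-- One step of the telescoping. The size of the touched set is part of the invariant, and
-- inclusion-exclusion trades the two sizes for that of the union plus a surplus of at least `i`.
union-cost : ∀ {N m i t₁ t₀} (S₁ S₀ : Subset N) → i ≤ ∣ S₁ ∩ S₀ ∣ →
  ∣ S₁ ∣ + m ≤ t₁ → ∣ S₀ ∣ + m ≤ t₀ → ∣ S₁ ∪ S₀ ∣ + (2 * m + i) ≤ t₁ + t₀
union-cost {m = m} {i} {t₁} {t₀} S₁ S₀ large cost₁ cost₀ = begin
  ∣ S₁ ∪ S₀ ∣ + (2 * m + i)                 ≤⟨ +-monoʳ-≤ (∣ S₁ ∪ S₀ ∣) (+-monoʳ-≤ (2 * m) large) ⟩
  ∣ S₁ ∪ S₀ ∣ + (2 * m + (∣ S₁ ∩ S₀ ∣))     ≡⟨ regroup₁ (∣ S₁ ∪ S₀ ∣) m (∣ S₁ ∩ S₀ ∣) ⟩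
  (∣ S₁ ∪ S₀ ∣) + (∣ S₁ ∩ S₀ ∣) + 2 * m     ≡⟨ cong (_+ 2 * m) (∣p∪q∣+∣p∩q∣≡∣p∣+∣q∣ S₁ S₀) ⟩
  (∣ S₁ ∣) + (∣ S₀ ∣) + 2 * m               ≡⟨ regroup₂ (∣ S₁ ∣) (∣ S₀ ∣) m ⟩
  (∣ S₁ ∣) + m + ((∣ S₀ ∣) + m)             ≤⟨ +-mono-≤ cost₁ cost₀ ⟩
  t₁ + t₀                                   ∎
  where
  open ≤-Reasoning
  regroup₁ : ∀ u m i → u + (2 * m + i) ≡ u + i + 2 * m
  regroup₁ = solve-∀
  regroup₂ : ∀ u v m → u + v + 2 * m ≡ u + m + (v + m)
  regroup₂ = solve-∀

-- `bound q h` is the sum of `2 ^ (h - 1 - l) * q l` over `l < h`: each node with `2 ^ l` visits per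
-- half contributes `q l`.
bound : (ℕ → ℕ) → ℕ → ℕ
bound q zero    = 0
bound q (suc l) = 2 * bound q l + q l

messageCount : (R w : ℕ) → ℕ → ℕ
messageCount R w zero    = 0
messageCount R w (suc r) = (2 ^ w) ^ R * (2 ^ w * 2 ^ w) ^ r

-- Information transfer between the halves of a node

module Transfer (W : WordSize) (D : DataStructure)
                (n k : ℕ) .{{_ : NonZero n}} .{{_ : NonZero k}} (k≤n : k ≤ n)
                (K : ℕ) (q : ℕ → ℕ) where

  open Caterpillar n k k≤n
  open Schedule n k k≤n K

  private
    w : ℕ
    w = bits W n

  -- The registers after the first half, and at most r - 1 changes to the memory
  -- before it; hence there is no message for r = 0.
  Message : ℕ → Set
  Message zero    = ⊥
  Message (suc r) = Vec (Word w) (registerCount D) × Vec (Word w × Word w) r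

  message-fin : ∀ r → Message r ↣ Fin (messageCount (registerCount D) w r)
  message-fin zero    = mk↣ {to = λ ()} λ { {()} }
  message-fin (suc r) = ×-fin (Vec-fin (registerCount D) (↣-id _)) (Vec-fin r (×-fin (↣-id _) (↣-id _)))

  receive : ∀ {r} → Message r → State W D n → State W D n
  receive {suc r} (ρ , es) M = machine ρ (patch es (memory M))

  -- A cell touched in the second half either was touched in the first half, and then the message
  -- contains its content, or it still has its content from `M`.
  send : ∀ r {M M₁ M₀ os₁ os₀ as₁ as₀ S₁ S₀ t₁ t₀} →
    Exec W D M os₁ as₁ S₁ t₁ M₁ → Exec W D M₁ os₀ as₀ S₀ t₀ M₀ → ∣ S₁ ∩ S₀ ∣ < r →
    ∃ λ (e : Message r) → ∃[ S ] ∃[ t ] ∃[ M′ ] Exec W D (receive e M) os₀ as₀ S t M′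
  send (suc r) {M} {M₁} {S₁ = S₁} {S₀} e₁ e₀ (s≤s small)
    with es , on , off ← patch-exists r (S₁ ∩ S₀) small (word w 0) (memory M) (memory M₁)
    = (registers M₁ , es) , Exec-local W D e₀ (λ c∈ → c∈) agree
    where
    agree : S₀ ⊨ memory M₁ ≈ patch es (memory M)
    agree {c} c∈S₀ with c ∈ₛ? S₁
    ... | yes c∈S₁ = sym (on (x∈p∩q⁺ (c∈S₁ , c∈S₀)))
    ... | no  c∉S₁ = trans (Exec-frame W D e₁ c∉S₁) (sym (off (c∉S₁ ∘ proj₁ ∘ x∈p∩q⁻ S₁ S₀)))

  -- A code descends to one cheap node and lists the choices off this path verbatim; at the node a
  -- message replaces the choices of the first half. A single visit has no code.
  data Code : ℕ → Set where
    here : ∀ {l} → Message (q l) → Choices K l → Code (suc l)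
    odd  : ∀ {l} → Code l → Choices K l → Code (suc l)
    even : ∀ {l} → Choices K l → Code l → Code (suc l)

  codeCount : ℕ → ℕ
  codeCount zero    = 0
  codeCount (suc l) = messageCount (registerCount D) w (q l) * choiceCount K l +
                      (codeCount l * choiceCount K l + choiceCount K l * codeCount l)

  code-fin : ∀ l → Code l ↣ Fin (codeCount l)
  code-fin zero    = mk↣ {to = λ ()} λ { {()} }
  code-fin (suc l) =
    ⊎-fin (×-fin (message-fin (q l)) (choices-fin K l))
          (⊎-fin (×-fin (code-fin l) (choices-fin K l)) (×-fin (choices-fin K l) (code-fin l)))
    ↣-∘ mk↣ {to = to} injective
    where
    to : Code (suc l) → Message (q l) × Choices K l ⊎ (Code l × Choices K l ⊎ Choices K l × Code l)
    to (here e x) = inj₁ (e , x)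
    to (odd c x)  = inj₂ (inj₁ (c , x))
    to (even x c) = inj₂ (inj₂ (x , c))
    injective : ∀ {c d} → to c ≡ to d → c ≡ d
    injective {here _ _} {here _ _} refl = refl
    injective {odd _ _}  {odd _ _}  refl = refl
    injective {even _ _} {even _ _} refl = refl

  module _ (Σₛ : Slots) where

    -- The decoder knows the earlier cuts `C` and the state `M`. Descending into the second half, it
    -- reruns the first half, which the code contains, to reach `M₁`.
    data Encodes : ∀ {l} (o s : ℕ) → List (Fin n) → State W D n → Choices K l → Code l → Set where
      here : ∀ {l o s C M} {x₁ x₀ : Choices K l} {e S t M′} →
        Exec W D (receive e M) (ops Σₛ o (2 * s) x₀)
          (answers Σₛ o (2 * s) x₀ (cuts Σₛ (o + s) (2 * s) x₁ ++ C)) S t M′ →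
        Encodes o s C M (x₁ ∥ x₀) (here e x₀)
      odd  : ∀ {l o s C M} {x₁ x₀ : Choices K l} {c} →
        Encodes (o + s) (2 * s) C M x₁ c →
        Encodes o s C M (x₁ ∥ x₀) (odd c x₀)
      even : ∀ {l o s C M} {x₁ x₀ : Choices K l} {c S t M₁} →
        Exec W D M (ops Σₛ (o + s) (2 * s) x₁) (answers Σₛ (o + s) (2 * s) x₁ C) S t M₁ →
        Encodes o (2 * s) (cuts Σₛ (o + s) (2 * s) x₁ ++ C) M₁ x₀ c →
        Encodes o s C M (x₁ ∥ x₀) (even x₁ c)

    -- At the cheap node both choices lead to the same operations from the same received state.
    -- Determinism makes the answers equal, and these determine the first half.
    Encodes-injective : ∀ {l o s C M} .{{_ : NonZero s}} {x y : Choices K l} {c} → InRange l o s →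
      Encodes o s C M x c → Encodes o s C M y c → x ≡ y
    Encodes-injective {suc l} {o} {s} {C} range (here {x₁ = x₁} {x₀} e) (here {x₁ = y₁} f) =
      cong (_∥ x₀) (first-half-determined Σₛ o s range x₁ y₁ x₀ C (proj₁ (Exec-deterministic W D e f)))
    Encodes-injective {suc l} {o} {s} range (odd {x₀ = x₀} e) (odd f) =
      cong (_∥ x₀) (Encodes-injective {{m*n≢0 2 s}} (inRange-odd l o s range) e f)
    Encodes-injective {suc l} {o} {s} range (even {x₁ = x₁} run e) (even run′ f)
      with _ , refl ← Exec-deterministic W D run run′
      = cong (x₁ ∥_) (Encodes-injective {{m*n≢0 2 s}} (inRange-even l o s range) e f)

    Costly : ∀ {l} (o s : ℕ) → List (Fin n) → State W D n → Choices K l → Set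
    Costly {l} o s C M x = ∃[ S ] ∃[ t ] ∃[ M′ ]
      (Exec W D M (ops Σₛ o s x) (answers Σₛ o s x C) S t M′ ×
       Servable W D weight (pruned (cuts Σₛ o s x ++ C)) M′ × ∣ S ∣ + bound q l ≤ t)

    -- The tree is processed in postorder; the first node whose halves share fewer than `q l` cells
    -- provides the code. If there is none, the costs add up by `union-cost`.
    costly-or-encoded : ∀ {l o s C M} .{{_ : NonZero s}} → Ready Σₛ l o s C →
      Servable W D weight (pruned C) M → (x : Choices K l) →
      Costly o s C M x ⊎ ∃ (Encodes o s C M x)
    costly-or-encoded {o = o} {s} R serve (choice j)
      with S , t , M′ , e , serve′ ← Servable-advance W D serve (history Σₛ R (choice j))
      = inj₁ (S , t , M′ , e , serve′ , ≤-trans (≤-reflexive (+-identityʳ _)) (Exec-∣S∣≤t W D e))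
    costly-or-encoded {suc l} {o} {s} {C} {M} R serve (x₁ ∥ x₀)
      with costly-or-encoded {{m*n≢0 2 s}} (ready-odd Σₛ R) serve x₁
    ... | inj₂ (c , e) = inj₂ (_ , odd e)
    ... | inj₁ (S₁ , t₁ , M₁ , e₁ , serve₁ , cost₁)
      with costly-or-encoded {{m*n≢0 2 s}} (ready-even Σₛ R x₁) serve₁ x₀
    ... | inj₂ (c , e) = inj₂ (_ , even e₁ e)
    ... | inj₁ (S₀ , t₀ , M₀ , e₀ , serve₀ , cost₀)
      with ∣ S₁ ∩ S₀ ∣ <? q l
    ... | yes small with e , S , t , M′ , run ← send (q l) e₁ e₀ small = inj₂ (_ , here run)
    ... | no  large = inj₁ (S₁ ∪ S₀ , t₁ + t₀ , M₀ , Exec-++ W D e₁ e₀ ,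
        subst (λ C → Servable W D weight (pruned C) M₀)
          (sym (++-assoc (cuts Σₛ o (2 * s) x₀) (cuts Σₛ (o + s) (2 * s) x₁) C)) serve₀ ,
        union-cost S₁ S₀ (≮⇒≥ large) cost₁ cost₀)

    -- If every choice had a code, two would share one. The choice found depends on `M`, which is
    -- allowed because `TimeBound` covers every legal sequence of the given length.
    costly-exists : ∀ {l o s C M} .{{_ : NonZero s}} → Ready Σₛ l o s C →
      Servable W D weight (pruned C) M → codeCount l < choiceCount K l →
      ∃ λ (x : Choices K l) → Costly o s C M x
    costly-exists {l} R serve fewer
      with search (λ i → costly-or-encoded R serve (Injection.to (fin-choices K l) i))
    ... | inj₁ (i , costly) = Injection.to (fin-choices K l) i , costly
    ... | inj₂ encoded
      with i , j , i<j , same ← Fin.pigeonhole fewer (λ i → Injection.to (code-fin l) (proj₁ (encoded i)))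
      = contradiction (Injection.injective (fin-choices K l) (Encodes-injective (Ready.inRange R)
            (proj₂ (encoded i))
            (subst (Encodes _ _ _ _ _) (sym (Injection.injective (code-fin l) same)) (proj₂ (encoded j)))))
          (Fin.<⇒≢ i<j)

  -- A tree of depth `h` has `2 ^ h - 1` inner nodes, and at each of them a message saves at least a
  -- factor `H` over the choices it replaces. The missing node is the summand `choiceCount K h`,
  -- which gives strict inequality for `H = 2 ^ h`.
  codes-vs-choices : ∀ {H} h → (∀ {l} → l < h → messageCount (registerCount D) w (q l) * H ≤ choiceCount K l) →
    codeCount h * H + choiceCount K h ≤ 2 ^ h * choiceCount K h
  codes-vs-choices zero    few = ≤-reflexive (sym (+-identityʳ K))
  codes-vs-choices {H} (suc l) few = begin
    (m * c + (d * c + c * d)) * H + c * c  ≡⟨ regroup₁ m c d H ⟩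
    c * (m * H + 2 * (d * H) + c)          ≤⟨ *-monoʳ-≤ c (+-monoˡ-≤ c (+-monoˡ-≤ (2 * (d * H)) (few ≤-refl))) ⟩
    c * (c + 2 * (d * H) + c)              ≡⟨ regroup₂ c (d * H) ⟩
    2 * c * (d * H + c)                    ≤⟨ *-monoʳ-≤ (2 * c) (codes-vs-choices l (few ∘ m<n⇒m<1+n)) ⟩
    2 * c * (2 ^ l * c)                    ≡⟨ regroup₃ c (2 ^ l) ⟩
    2 * 2 ^ l * (c * c)                    ∎
    where
    open ≤-Reasoning
    m = messageCount (registerCount D) w (q l)
    c = choiceCount K l
    d = codeCount l
    regroup₁ : ∀ m c d H → (m * c + (d * c + c * d)) * H + c * c ≡ c * (m * H + 2 * (d * H) + c)
    regroup₁ = solve-∀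
    regroup₂ : ∀ c d → c * (c + 2 * d + c) ≡ 2 * c * (d + c)
    regroup₂ = solve-∀
    regroup₃ : ∀ c l → 2 * c * (l * c) ≡ 2 * l * (c * c)
    regroup₃ = solve-∀

-- Sequences of rounds

module Rounds (W : WordSize) (D : DataStructure) (n h K rounds : ℕ) .{{_ : NonZero n}}
              (fits : 2 ^ h * (1 + K + rounds) ≤ n) (q : ℕ → ℕ) where

  private
    k : ℕ
    k = 2 ^ h

    instance
      k≢0 : NonZero k
      k≢0 = m^n≢0 2 h

    k≤n : k ≤ n
    k≤n = ≤-trans (m≤m*n k (1 + K + rounds)) fits

  open Caterpillar n k k≤n public
  open Schedule n k k≤n K public
  open Transfer W D n k k≤n K q public

  -- Vertices come in blocks of `k`, one per position. Block 0 is the path, hence `suc ℓ`; leaf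
  -- levels below `K` are the initial candidates, and round `r` refills from level `K + r`.
  leafℕ : ℕ → ℕ → ℕ
  leafℕ i ℓ = i + suc ℓ * k

  leafℕ-<-level : ∀ {i ℓ m} → i < k → ℓ < m → leafℕ i ℓ < suc m * k
  leafℕ-<-level {i} {ℓ} {m} i<k ℓ<m = begin-strict
    i + suc ℓ * k  <⟨ +-monoˡ-< (suc ℓ * k) i<k ⟩
    k + suc ℓ * k  ≤⟨ *-monoˡ-≤ k (s≤s ℓ<m) ⟩
    suc m * k      ∎
    where open ≤-Reasoning

  leafℕ<n : ∀ {i ℓ} → i < k → ℓ < K + rounds → leafℕ i ℓ < n
  leafℕ<n i<k ℓ< = <-≤-trans (leafℕ-<-level i<k ℓ<) (≤-trans (≤-reflexive (*-comm (suc (K + rounds)) k)) fits)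

  leaf : ℕ → ℕ → Fin n
  leaf i ℓ = vertex (leafℕ i ℓ)

  module _ {i ℓ : ℕ} (i<k : i < k) (ℓ< : ℓ < K + rounds) where

    toℕ-leaf : toℕ (leaf i ℓ) ≡ leafℕ i ℓ
    toℕ-leaf = toℕ-vertex (leafℕ<n i<k ℓ<)

    position-leaf : position (leaf i ℓ) ≡ i
    position-leaf = trans (cong (_% k) toℕ-leaf) (trans ([m+kn]%n≡m%n i (suc ℓ) k) (m<n⇒m%n≡m i<k))

    isLeaf-leaf : IsLeaf (leaf i ℓ)
    isLeaf-leaf = subst (k ≤_) (sym toℕ-leaf) (≤-trans (m≤m+n k (ℓ * k)) (m≤n+m (suc ℓ * k) i))

  leaf-injective : ∀ {i ℓ ℓ′} → i < k → ℓ < K + rounds → ℓ′ < K + rounds → leaf i ℓ ≡ leaf i ℓ′ → ℓ ≡ ℓ′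
  leaf-injective {i} {ℓ} {ℓ′} i<k ℓ< ℓ′< same = suc-injective (*-cancelʳ-≡ (suc ℓ) (suc ℓ′) k (+-cancelˡ-≡ i _ _
    (trans (sym (toℕ-leaf i<k ℓ<)) (trans (cong toℕ same) (toℕ-leaf i<k ℓ′<)))))

  -- After r rounds, all leaves from level K + r on are still untouched.
  record Invariant (r : ℕ) (C : List (Fin n)) (M : State W D n) : Set where
    open Slots
    field
      slots     : Slots
      unique    : Unique C
      leaves    : All IsLeaf C
      available : ∀ {i} → i < k → ∀ j → slot slots i j ∉ C
      slot-old  : ∀ {i} → i < k → ∀ j → toℕ (slot slots i j) < suc (K + r) * k
      cut-old   : ∀ {c} → c ∈ C → toℕ c < suc (K + r) * k
      servable  : Servable W D weight (pruned C) M

    ready : Ready slots h 0 1 C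
    ready = record
      { unique    = unique
      ; leaves    = leaves
      ; inRange   = λ {p} p< → subst (_< k) (sym (*-identityˡ p)) p<
      ; available = λ {p} p< j → subst (λ i → slot slots i j ∉ C) (sym (*-identityˡ p)) (available p< j)
      }

  initial : ∀ {M} → Servable W D weight (pruned []) M → Invariant 0 [] M
  initial serve = record
    { slots = record
      { slot      = λ i j → leaf i (toℕ j)
      ; slot-pos  = λ i<k j → position-leaf i<k (level< j)
      ; slot-leaf = λ i<k j → isLeaf-leaf i<k (level< j)
      ; slot-inj  = λ i<k {j} {j′} same → Fin.toℕ-injective (leaf-injective i<k (level< j) (level< j′) same)
      }
    ; unique    = []
    ; leaves    = []
    ; available = λ _ _ ()
    ; slot-old  = λ i<k j → subst (_< suc (K + 0) * k) (sym (toℕ-leaf i<k (level< j)))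
                    (leafℕ-<-level i<k (<-≤-trans (Fin.toℕ<n j) (m≤m+n K 0)))
    ; cut-old   = λ ()
    ; servable  = serve
    }
    where
    level< : (j : Fin K) → toℕ j < K + rounds
    level< j = <-≤-trans (Fin.toℕ<n j) (m≤m+n K rounds)

  -- Only the candidate that was cut is replaced, so a round uses up a single level of leaves.
  refill : (ℕ → Fin K → Fin n) → ℕ → (ℕ → Fin K) → ℕ → Fin K → Fin n
  refill slot ℓ x i j with j Fin.≟ x i
  ... | yes _ = leaf i ℓ
  ... | no  _ = slot i j

  module _ {r C M} (r<rounds : r < rounds) (I : Invariant r C M) (x : Choices K h) where

    open Invariant I
    open Slots slots

    private
      ℓ< : K + r < K + rounds
      ℓ< = +-monoʳ-< K r<rounds

      slot′ : ℕ → Fin K → Fin n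
      slot′ = refill slot (K + r) (at x)

      cuts′ : List (Fin n)
      cuts′ = cuts slots 0 1 x

      cut-slot : ∀ {c} → c ∈ cuts′ → ∃[ i ] (i < k × c ≡ slot i (at x i))
      cut-slot c∈ with p , p< , refl ← ∈-cuts slots 0 1 x c∈
        = p , p< , cong (λ i → slot i (at x p)) (*-identityˡ p)

      old : ∀ {c} → c ∈ cuts′ ++ C → toℕ c < suc (K + r) * k
      old c∈ with ∈-++⁻ cuts′ c∈
      ... | inj₂ c∈C = cut-old c∈C
      ... | inj₁ c∈′ with i , i<k , refl ← cut-slot c∈′ = slot-old i<k _

      leaf-fresh : ∀ {i u} → i < k → toℕ u < suc (K + r) * k → u ≢ leaf i (K + r)
      leaf-fresh {i} i<k u< refl =
        <⇒≱ u< (≤-trans (m≤n+m (suc (K + r) * k) i) (≤-reflexive (sym (toℕ-leaf i<k ℓ<))))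

      pos′ : ∀ {i} → i < k → ∀ j → position (slot′ i j) ≡ i
      pos′ {i} i<k j with j Fin.≟ at x i
      ... | yes _ = position-leaf i<k ℓ<
      ... | no  _ = slot-pos i<k j

      leaf′ : ∀ {i} → i < k → ∀ j → IsLeaf (slot′ i j)
      leaf′ {i} i<k j with j Fin.≟ at x i
      ... | yes _ = isLeaf-leaf i<k ℓ<
      ... | no  _ = slot-leaf i<k j

      inj′ : ∀ {i} → i < k → ∀ {j j′} → slot′ i j ≡ slot′ i j′ → j ≡ j′
      inj′ {i} i<k {j} {j′} same with j Fin.≟ at x i | j′ Fin.≟ at x i
      ... | yes refl | yes refl = refl
      ... | yes _    | no  _    = contradiction (sym same) (leaf-fresh i<k (slot-old i<k j′))
      ... | no  _    | yes _    = contradiction same (leaf-fresh i<k (slot-old i<k j))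
      ... | no  _    | no  _    = slot-inj i<k same

      old′ : ∀ {i} → i < k → ∀ j → toℕ (slot′ i j) < suc (K + suc r) * k
      old′ {i} i<k j with j Fin.≟ at x i
      ... | yes _ = subst (_< suc (K + suc r) * k) (sym (toℕ-leaf i<k ℓ<)) (leafℕ-<-level i<k (+-monoʳ-< K ≤-refl))
      ... | no  _ = <-≤-trans (slot-old i<k j) (*-monoˡ-≤ k (s≤s (+-monoʳ-≤ K (n≤1+n r))))

      available′ : ∀ {i} → i < k → ∀ j → slot′ i j ∉ cuts′ ++ C
      available′ {i} i<k j ∈C′ with j Fin.≟ at x i
      ... | yes _ = leaf-fresh i<k (old ∈C′) refl
      ... | no j≢ with ∈-++⁻ cuts′ ∈C′
      ...   | inj₂ ∈C = available i<k j ∈C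
      ...   | inj₁ ∈′ with i′ , i′<k , same ← cut-slot ∈′
              with refl ← trans (sym (slot-pos i<k j)) (trans (cong position same) (slot-pos i′<k _))
              = j≢ (slot-inj i<k same)

    next : ∀ {M′} → Servable W D weight (pruned (cuts slots 0 1 x ++ C)) M′ →
           Invariant (suc r) (cuts slots 0 1 x ++ C) M′
    next serve = record
      { slots     = record { slot = slot′ ; slot-pos = pos′ ; slot-leaf = leaf′ ; slot-inj = inj′ }
      ; unique    = cuts-unique slots ready x
      ; leaves    = cuts-leaves slots ready x
      ; available = available′
      ; slot-old  = old′
      ; cut-old   = λ c∈ → <-≤-trans (old c∈) (*-monoˡ-≤ k (s≤s (+-monoʳ-≤ K (n≤1+n r))))
      ; servable  = serve
      }

  -- Padding for sequences of exactly `m n` operations: queries are legal at any time and leave the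
  -- forest unchanged.
  queries : ∀ {C} → Unique C → All IsLeaf C → ∀ m →
    History weight (pruned C) (replicate m (subtree-sum (vertex 0))) (replicate m (suffixSum C 0))
  queries uniq leaves zero    = []
  queries uniq leaves (suc m) =
    subtree-sum (subtreeSum-pruned uniq leaves (m^n>0 2 h)) (queries uniq leaves m)

  -- An adversary picks each round against the state in which the previous round ended.
  play : codeCount h < choiceCount K h → ∀ m extra {r C M} → r + m ≤ rounds → Invariant r C M →
    ∃[ os ] ∃[ as ] ∃[ t ]
      (History weight (pruned C) os as × length os ≡ m * (2 * k) + extra ×
       Serves W D M os as t × m * bound q h ≤ t)
  play fewer zero extra _ I
    with t , s ← Invariant.servable I (queries (Invariant.unique I) (Invariant.leaves I) extra)
    = _ , _ , t , queries (Invariant.unique I) (Invariant.leaves I) extra , length-replicate extra , s , z≤n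
  play fewer (suc m) extra {r} r+m≤ I
    with x , S , t₁ , M₁ , e , serve , cost ←
      costly-exists (Invariant.slots I) (Invariant.ready I) (Invariant.servable I) fewer
    with os , as , t , hist , len , s , t≥ ←
      play fewer m extra (≤-trans (≤-reflexive (sym (+-suc r m))) r+m≤)
        (next (≤-trans (s≤s (m≤m+n r m)) (≤-trans (≤-reflexive (sym (+-suc r m))) r+m≤)) I x serve)
    = ops Σₛ 0 1 x ++ os , _ , t₁ + t , history Σₛ (Invariant.ready I) x hist ,
      trans (length-++ (ops Σₛ 0 1 x))
        (trans (cong₂ _+_ (length-ops Σₛ 0 1 x) len) (sym (+-assoc (2 * k) (m * (2 * k)) extra))) ,
      Exec⇒Serves-++ W D e s ,
      +-mono-≤ (≤-trans (m≤n+m (bound q h) (∣ S ∣)) cost) t≥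
    where Σₛ = Invariant.slots I

  weight-fits : ∀ v → FitsWord (bits W n) (weight v)
  weight-fits v =
    ℤ.≤-trans (ℤ.neg-≤-pos {2 ^ (bits W n ∸ 1)} {0}) (ℤ.+≤+ z≤n) ,
    +<+ (<-≤-trans (Fin.toℕ<n v) (half (bits W n) (room W n)))
    where
    -- The factor two in `room` pays for the sign bit. For `b = 0` the truncated subtraction leaves
    -- the bound `2 ^ 0`.
    half : ∀ b → n + n ≤ 2 ^ b → n ≤ 2 ^ (b ∸ 1)
    half zero    2n≤1 = ≤-trans (m≤m+n n n) 2n≤1
    half (suc b) 2n≤  = *-cancelˡ-≤ 2 (≤-trans (≤-reflexive (cong (λ z → n + z) (+-identityʳ n))) 2n≤)

  time-lower-bound : ∀ {m T} → Maintains W D → TimeBound W D m T →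
    codeCount h < choiceCount K h → rounds * (2 * k) ≤ m n → rounds * bound q h ≤ T n
  time-lower-bound {m} {T} maintains timeBound fewer enough
    with M , init , serve ← maintains caterpillar weight weight-fits
    with os , as , t , hist , len , s , t≥ ← play fewer rounds (m n ∸ rounds * (2 * k)) ≤-refl (initial serve)
    = ≤-trans t≥ (timeBound caterpillar weight weight-fits init hist (trans len (m+[n∸m]≡n enough)) s)

-- Choice of parameters

n<2^n : ∀ n → n < 2 ^ n
n<2^n zero    = z<s
n<2^n (suc n) = +-mono-≤ (m^n>0 2 n) (≤-trans (n<2^n n) (m≤m+n (2 ^ n) 0))

n<2^1+⌊log₂n⌋ : ∀ n → n < 2 ^ suc ⌊log₂ n ⌋
n<2^1+⌊log₂n⌋ n = ≰⇒> λ 2^≤n →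
  1+n≰n (≤-trans (≤-reflexive (sym (⌊log₂[2^n]⌋≡n (suc ⌊log₂ n ⌋)))) (⌊log₂⌋-mono-≤ 2^≤n))

2*⌊n/2⌋≤n : ∀ n → 2 * ⌊ n /2⌋ ≤ n
2*⌊n/2⌋≤n n = begin
  2 * ⌊ n /2⌋          ≡⟨ cong (λ m → ⌊ n /2⌋ + m) (+-identityʳ ⌊ n /2⌋) ⟩
  ⌊ n /2⌋ + ⌊ n /2⌋    ≤⟨ +-monoʳ-≤ ⌊ n /2⌋ (⌊n/2⌋≤⌈n/2⌉ n) ⟩
  ⌊ n /2⌋ + ⌈ n /2⌉    ≡⟨ ⌊n/2⌋+⌈n/2⌉≡n n ⟩
  n                    ∎
  where open ≤-Reasoning

2^⌊log₂n⌋≤n : ∀ n .{{_ : NonZero n}} → 2 ^ ⌊log₂ n ⌋ ≤ n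
2^⌊log₂n⌋≤n n = go _ n refl
  where
  go : ∀ g n .{{_ : NonZero n}} → ⌊log₂ n ⌋ ≡ g → 2 ^ g ≤ n
  go zero    n             _    = >-nonZero⁻¹ n
  go (suc g) 1             ()
  go (suc g) (suc (suc n)) same = ≤-trans
    (*-monoʳ-≤ 2 (go g ⌊ 2 + n /2⌋ (trans (⌊log₂⌊n/2⌋⌋≡⌊log₂n⌋∸1 (2 + n)) (cong (_∸ 1) same))))
    (2*⌊n/2⌋≤n (2 + n))

-- For `g = ⌊log₂ n ⌋` and `k = 2 ^ h` this means `4 * (k * k) ≤ n ≤ 16 * (k * k)`; the offset 2
-- makes room for the path and all leaf levels.
half-minus-one : ∀ g → 2 ≤ g → ∃[ h ] (2 * h + 2 ≤ g × g ≤ 2 * h + 3)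
half-minus-one (suc (suc g)) (s≤s (s≤s z≤n)) with even-or-odd g
... | h , inj₁ refl =
  h , ≤-reflexive (+-comm (2 * h) 2) , ≤-trans (≤-reflexive (+-comm 2 (2 * h))) (+-monoʳ-≤ (2 * h) (n≤1+n 2))
... | h , inj₂ refl = h , ≤-trans (≤-reflexive (+-comm (2 * h) 2)) (n≤1+n _) , ≤-reflexive (+-comm 3 (2 * h))

choiceCount-2^ : ∀ h l → choiceCount (2 ^ h) l ≡ 2 ^ (h * 2 ^ l)
choiceCount-2^ h zero    = cong (2 ^_) (sym (*-identityʳ h))
choiceCount-2^ h (suc l) = begin
  choiceCount (2 ^ h) l * choiceCount (2 ^ h) l ≡⟨ cong₂ _*_ (choiceCount-2^ h l) (choiceCount-2^ h l) ⟩
  2 ^ (h * 2 ^ l) * 2 ^ (h * 2 ^ l)             ≡⟨ ^-distribˡ-+-* 2 (h * 2 ^ l) (h * 2 ^ l) ⟨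
  2 ^ (h * 2 ^ l + h * 2 ^ l)                   ≡⟨ cong (2 ^_) (double h (2 ^ l)) ⟩
  2 ^ (h * 2 ^ suc l)                           ∎
  where
  open ≡-Reasoning
  double : ∀ h m → h * m + h * m ≡ h * (2 * m)
  double = solve-∀

messageCount-2^ : ∀ R w r → messageCount R w (suc r) ≡ 2 ^ (w * (R + 2 * r))
messageCount-2^ R w r = begin
  (2 ^ w) ^ R * (2 ^ w * 2 ^ w) ^ r        ≡⟨ cong (λ z → (2 ^ w) ^ R * z ^ r) (sym (^-distribˡ-+-* 2 w w)) ⟩
  (2 ^ w) ^ R * (2 ^ (w + w)) ^ r          ≡⟨ cong₂ _*_ (^-*-assoc 2 w R) (^-*-assoc 2 (w + w) r) ⟩
  2 ^ (w * R) * 2 ^ ((w + w) * r)          ≡⟨ ^-distribˡ-+-* 2 (w * R) ((w + w) * r) ⟨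
  2 ^ (w * R + (w + w) * r)                ≡⟨ cong (2 ^_) (regroup w R r) ⟩
  2 ^ (w * (R + 2 * r))                    ∎
  where
  open ≡-Reasoning
  regroup : ∀ w R r → w * R + (w + w) * r ≡ w * (R + 2 * r)
  regroup = solve-∀

module Threshold (B R : ℕ) where

  -- From this level on `q l ≥ 2 ^ R > R`, so the registers take no more space than `q l` words.
  lowest : ℕ
  lowest = B + 2 + R

  -- Fewer than q l edits must be shorter than the 2 ^ l choices they describe;
  -- below the lowest level the registers alone may be too long.
  q : ℕ → ℕ
  q l with lowest ≤? l
  ... | yes _ = 2 ^ (l ∸ (B + 2))
  ... | no  _ = 0

  q-above : ∀ j → q (lowest + j) ≡ 2 ^ (R + j)
  q-above j with lowest ≤? lowest + j
  ... | yes _ = cong (2 ^_) (trans (cong (_∸ (B + 2)) (+-assoc (B + 2) R j)) (m+n∸m≡n (B + 2) (R + j)))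
  ... | no ≰  = contradiction (m≤m+n lowest j) ≰

  -- Each of the `j` levels from `lowest` on contributes the same amount, `2 ^ (R + j - 1)`: going
  -- up a level doubles `q` and halves the number of nodes.
  bound-q : ∀ j → j * 2 ^ (R + j) ≤ 2 * bound q (lowest + j)
  bound-q zero    = z≤n
  bound-q (suc j) = begin
    suc j * 2 ^ (R + suc j)                      ≡⟨ cong (λ e → suc j * 2 ^ e) (+-suc R j) ⟩
    suc j * (2 * 2 ^ (R + j))                    ≡⟨ regroup j (2 ^ (R + j)) ⟩
    2 * (j * 2 ^ (R + j) + 2 ^ (R + j))          ≤⟨ *-monoʳ-≤ 2 (+-mono-≤ (bound-q j) (≤-reflexive (sym (q-above j)))) ⟩
    2 * (2 * bound q (lowest + j) + q (lowest + j)) ≡⟨ cong (λ e → 2 * bound q e) (+-suc lowest j) ⟨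
    2 * bound q (lowest + suc j)                 ∎
    where
    open ≤-Reasoning
    regroup : ∀ j m → suc j * (2 * m) ≡ 2 * (j * m + m)
    regroup = solve-∀

  -- At least half of the `h` levels are at or above `lowest`. The factor `2 ^ (B + 2)` is the ratio
  -- of `2 ^ l` to `q l` there.
  bound-q-h : ∀ {h} → lowest + lowest ≤ h → h * 2 ^ h ≤ 4 * 2 ^ (B + 2) * bound q h
  bound-q-h {h} 2lowest≤h = subst (λ h → h * 2 ^ h ≤ 4 * 2 ^ (B + 2) * bound q h) lowest+j≡h (begin
    (lowest + j) * 2 ^ (lowest + j)            ≡⟨ cong (λ e → (lowest + j) * 2 ^ e) (+-assoc (B + 2) R j) ⟩
    (lowest + j) * 2 ^ (B + 2 + (R + j))       ≡⟨ cong ((lowest + j) *_) (^-distribˡ-+-* 2 (B + 2) (R + j)) ⟩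
    (lowest + j) * (2 ^ (B + 2) * 2 ^ (R + j)) ≤⟨ *-monoˡ-≤ _ (+-monoˡ-≤ j lowest≤j) ⟩
    (j + j) * (2 ^ (B + 2) * 2 ^ (R + j))      ≡⟨ regroup₁ j (2 ^ (B + 2)) (2 ^ (R + j)) ⟩
    2 * 2 ^ (B + 2) * (j * 2 ^ (R + j))        ≤⟨ *-monoʳ-≤ (2 * 2 ^ (B + 2)) (bound-q j) ⟩
    2 * 2 ^ (B + 2) * (2 * bound q (lowest + j)) ≡⟨ regroup₂ (2 ^ (B + 2)) (bound q (lowest + j)) ⟩
    4 * 2 ^ (B + 2) * bound q (lowest + j)     ∎)
    where
    open ≤-Reasoning
    j : ℕ
    j = h ∸ lowest
    lowest+j≡h : lowest + j ≡ h
    lowest+j≡h = m+[n∸m]≡n (≤-trans (m≤m+n lowest lowest) 2lowest≤h)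
    lowest≤j : lowest ≤ j
    lowest≤j = ≤-trans (≤-reflexive (sym (m+n∸m≡n lowest lowest))) (∸-monoˡ-≤ lowest 2lowest≤h)
    regroup₁ : ∀ j c m → (j + j) * (c * m) ≡ 2 * c * (j * m)
    regroup₁ = solve-∀
    regroup₂ : ∀ c m → 2 * c * (2 * m) ≡ 4 * c * m
    regroup₂ = solve-∀

  -- In bits, with `q l = suc r`: a message has `w * (R + 2 * r)`, at most `3 * 2 ^ B * h * q l`,
  -- while the choices have `h * 2 ^ l = 4 * 2 ^ B * h * q l`. The remaining quarter covers the
  -- factor `2 ^ h`, the price of naming a node. Below `lowest` there are no messages.
  few-messages : ∀ {w h} → w ≤ 2 ^ B * h → ∀ l → messageCount R w (q l) * 2 ^ h ≤ choiceCount (2 ^ h) l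
  few-messages {w} {h} w≤ l with lowest ≤? l
  ... | no  _ = z≤n
  ... | yes lowest≤l with 2 ^ (l ∸ (B + 2)) in q≡
  ...   | zero  = z≤n
  ...   | suc r = begin
    messageCount R w (suc r) * 2 ^ h      ≡⟨ cong (_* 2 ^ h) (messageCount-2^ R w r) ⟩
    2 ^ (w * (R + 2 * r)) * 2 ^ h         ≡⟨ ^-distribˡ-+-* 2 (w * (R + 2 * r)) h ⟨
    2 ^ (w * (R + 2 * r) + h)             ≤⟨ ^-monoʳ-≤ 2 exponent ⟩
    2 ^ (h * 2 ^ l)                       ≡⟨ choiceCount-2^ h l ⟨
    choiceCount (2 ^ h) l                 ∎
    where
    open ≤-Reasoning
    B+2≤l : B + 2 ≤ l
    B+2≤l = ≤-trans (m≤m+n (B + 2) R) lowest≤l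
    R≤ : R ≤ suc r
    R≤ = begin
      R                     ≤⟨ ≤-trans (≤-reflexive (sym (m+n∸m≡n (B + 2) R))) (∸-monoˡ-≤ (B + 2) lowest≤l) ⟩
      l ∸ (B + 2)           ≤⟨ <⇒≤ (n<2^n (l ∸ (B + 2))) ⟩
      2 ^ (l ∸ (B + 2))     ≡⟨ q≡ ⟩
      suc r                 ∎
    regroup₁ : ∀ b h x → b * h * x + h ≡ h * (b * x + 1)
    regroup₁ = solve-∀
    regroup₂ : ∀ b r → b * (suc r + 2 * r) + b + b * (2 + r) ≡ b * 4 * suc r
    regroup₂ = solve-∀
    exponent : w * (R + 2 * r) + h ≤ h * 2 ^ l
    exponent = begin
      w * (R + 2 * r) + h                ≤⟨ +-monoˡ-≤ h (*-monoˡ-≤ (R + 2 * r) w≤) ⟩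
      2 ^ B * h * (R + 2 * r) + h        ≡⟨ regroup₁ (2 ^ B) h (R + 2 * r) ⟩
      h * (2 ^ B * (R + 2 * r) + 1)      ≤⟨ *-monoʳ-≤ h (+-mono-≤ (*-monoʳ-≤ (2 ^ B) (+-monoˡ-≤ (2 * r) R≤)) (m^n>0 2 B)) ⟩
      h * (2 ^ B * (suc r + 2 * r) + 2 ^ B) ≤⟨ *-monoʳ-≤ h (m≤m+n _ (2 ^ B * (2 + r))) ⟩
      h * (2 ^ B * (suc r + 2 * r) + 2 ^ B + 2 ^ B * (2 + r)) ≡⟨ cong (h *_) (regroup₂ (2 ^ B) r) ⟩
      h * (2 ^ B * 4 * suc r)            ≡⟨ cong₂ (λ x y → h * (x * y)) (sym (^-distribˡ-+-* 2 B 2)) (sym q≡) ⟩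
      h * (2 ^ (B + 2) * 2 ^ (l ∸ (B + 2))) ≡⟨ cong (h *_) (^-distribˡ-+-* 2 (B + 2) (l ∸ (B + 2))) ⟨
      h * 2 ^ (B + 2 + (l ∸ (B + 2)))    ≡⟨ cong (λ e → h * 2 ^ e) (m+[n∸m]≡n B+2≤l) ⟩
      h * 2 ^ l                          ∎

theorem5 : (W : WordSize) (D : DataStructure) → Maintains W D →
    (m T : ℕ → ℕ) → m ∈Θ (λ n → n) → TimeBound W D m T →
    T ∈Ω (λ n → n * ⌊log₂ n ⌋)
theorem5 W D maintains m T ((c , n₁ , 0<c , n≤cm) , _) timeBound
  with a , n₂ , _ , bits≤ ← proj₂ (bits∈Θlog W) =
  -- The power of two forces `h` to be at least `H`; `n₁` and `n₂` are the thresholds of the two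
  -- asymptotic hypotheses.
  factor , 2 ^ (2 * H + 3) + n₁ + n₂ ,
  *-mono-≤ (*-mono-≤ {1} {320} (s≤s z≤n) (m^n>0 2 c)) (m^n>0 2 (β + 2)) , large
  where
  β regs : ℕ
  -- The 5 is that of `g ≤ 5 * h`, and `5 * a ≤ 2 ^ β` puts the word size into the form required by
  -- `few-messages`.
  β = 5 * a
  regs = registerCount D

  open Threshold β regs

  H factor : ℕ
  -- The summands secure `lowest + lowest ≤ h` for `bound-q-h`, `c ≤ h` for the number of rounds,
  -- and `1 ≤ h` for `g ≤ 5 * h`.
  H = lowest + lowest + c + 1
  -- Here `320 = 16 * 5 * 4`, from `n ≤ 16 * (k * k)`, `g ≤ 5 * h` and `bound-q-h`; `2 ^ c` is the
  -- ratio of `k` to the number of rounds.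
  factor = 320 * 2 ^ c * 2 ^ (β + 2)

  module _ (n : ℕ) (n≥ : 2 ^ (2 * H + 3) + n₁ + n₂ ≤ n) where
    open ≤-Reasoning

    g : ℕ
    g = ⌊log₂ n ⌋

    instance
      n≢0 : NonZero n
      n≢0 = >-nonZero (<-≤-trans (m^n>0 2 (2 * H + 3)) (≤-trans (m≤m+n _ n₁) (≤-trans (m≤m+n _ n₂) n≥)))
      c≢0 : NonZero c
      c≢0 = >-nonZero 0<c

    2H+3≤g : 2 * H + 3 ≤ g
    2H+3≤g = ≤-trans (≤-reflexive (sym (⌊log₂[2^n]⌋≡n (2 * H + 3))))
      (⌊log₂⌋-mono-≤ (≤-trans (m≤m+n _ n₁) (≤-trans (m≤m+n _ n₂) n≥)))

    module _ (h : ℕ) (2h+2≤g : 2 * h + 2 ≤ g) (g≤2h+3 : g ≤ 2 * h + 3) where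

      k ρ : ℕ
      k = 2 ^ h
      -- The number of rounds: `ρ * (2 * k)` operations stay within `m n`, because `c ≤ 2 ^ c` and
      -- `n ≤ c * m n`.
      ρ = 2 ^ (h ∸ c)

      H≤h : H ≤ h
      H≤h = *-cancelˡ-≤ 2 (+-cancelʳ-≤ 3 (2 * H) (2 * h) (≤-trans 2H+3≤g g≤2h+3))

      2lowest≤h : lowest + lowest ≤ h
      2lowest≤h = ≤-trans (m≤m+n _ c) (≤-trans (m≤m+n _ 1) H≤h)

      c≤h : c ≤ h
      c≤h = ≤-trans (m≤n+m c (lowest + lowest)) (≤-trans (m≤m+n _ 1) H≤h)

      1≤h : 1 ≤ h
      1≤h = ≤-trans (m≤n+m 1 (lowest + lowest + c)) H≤h

      g≤5h : g ≤ 5 * h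
      g≤5h = begin
        g              ≤⟨ g≤2h+3 ⟩
        2 * h + 3      ≤⟨ +-monoʳ-≤ (2 * h) (*-monoʳ-≤ 3 1≤h) ⟩
        2 * h + 3 * h  ≡⟨ *-distribʳ-+ h 2 3 ⟨
        5 * h          ∎

      bits≤2^β*h : bits W n ≤ 2 ^ β * h
      bits≤2^β*h = begin
        bits W n     ≤⟨ bits≤ n (≤-trans (m≤n+m n₂ _) n≥) ⟩
        a * g        ≤⟨ *-monoʳ-≤ a g≤5h ⟩
        a * (5 * h)  ≡⟨ regroup a h ⟩
        5 * a * h    ≤⟨ *-monoˡ-≤ h (<⇒≤ (n<2^n β)) ⟩
        2 ^ β * h    ∎
        where
        regroup : ∀ a h → a * (5 * h) ≡ 5 * a * h
        regroup = solve-∀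

      4k²≤n : 4 * (k * k) ≤ n
      4k²≤n = begin
        4 * (k * k)        ≡⟨ cong (4 *_) (^-distribˡ-+-* 2 h h) ⟨
        4 * 2 ^ (h + h)    ≡⟨ ^-distribˡ-+-* 2 2 (h + h) ⟨
        2 ^ (2 + (h + h))  ≡⟨ cong (2 ^_) (regroup h) ⟩
        2 ^ (2 * h + 2)    ≤⟨ ^-monoʳ-≤ 2 2h+2≤g ⟩
        2 ^ g              ≤⟨ 2^⌊log₂n⌋≤n n ⟩
        n                  ∎
        where
        regroup : ∀ h → 2 + (h + h) ≡ 2 * h + 2
        regroup = solve-∀

      n≤16k² : n ≤ 16 * (k * k)
      n≤16k² = begin
        n                  ≤⟨ <⇒≤ (n<2^1+⌊log₂n⌋ n) ⟩
        2 ^ suc g          ≤⟨ ^-monoʳ-≤ 2 (s≤s g≤2h+3) ⟩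
        2 ^ (1 + (2 * h + 3)) ≡⟨ cong (2 ^_) (regroup h) ⟩
        2 ^ (4 + (h + h))  ≡⟨ ^-distribˡ-+-* 2 4 (h + h) ⟩
        16 * 2 ^ (h + h)   ≡⟨ cong (16 *_) (^-distribˡ-+-* 2 h h) ⟩
        16 * (k * k)       ∎
        where
        regroup : ∀ h → 1 + (2 * h + 3) ≡ 4 + (h + h)
        regroup = solve-∀

      k≡2^cρ : 2 ^ c * ρ ≡ k
      k≡2^cρ = trans (sym (^-distribˡ-+-* 2 c (h ∸ c))) (cong (2 ^_) (m+[n∸m]≡n c≤h))

      fits : k * (1 + k + ρ) ≤ n
      fits = begin
        k * (1 + k + ρ)  ≤⟨ *-monoʳ-≤ k (+-mono-≤ (+-monoˡ-≤ k (m^n>0 2 h)) (^-monoʳ-≤ 2 (m∸n≤m h c))) ⟩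
        k * (k + k + k)  ≤⟨ *-monoʳ-≤ k (m≤m+n (k + k + k) k) ⟩
        k * (k + k + k + k) ≡⟨ regroup k ⟩
        4 * (k * k)      ≤⟨ 4k²≤n ⟩
        n                ∎
        where
        regroup : ∀ k → k * (k + k + k + k) ≡ 4 * (k * k)
        regroup = solve-∀

      enough : ρ * (2 * k) ≤ m n
      enough = *-cancelˡ-≤ c (begin
        c * (ρ * (2 * k))      ≤⟨ *-monoˡ-≤ (ρ * (2 * k)) (<⇒≤ (n<2^n c)) ⟩
        2 ^ c * (ρ * (2 * k))  ≡⟨ *-assoc (2 ^ c) ρ (2 * k) ⟨
        2 ^ c * ρ * (2 * k)    ≡⟨ cong (_* (2 * k)) k≡2^cρ ⟩
        k * (2 * k)            ≤⟨ m≤m+n _ (k * (2 * k)) ⟩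
        k * (2 * k) + k * (2 * k) ≡⟨ regroup k ⟩
        4 * (k * k)            ≤⟨ 4k²≤n ⟩
        n                      ≤⟨ n≤cm n (≤-trans (≤-trans (m≤n+m n₁ (2 ^ (2 * H + 3))) (m≤m+n _ n₂)) n≥) ⟩
        c * m n                ∎)
        where
        regroup : ∀ k → k * (2 * k) + k * (2 * k) ≡ 4 * (k * k)
        regroup = solve-∀

      open Rounds W D n h k ρ fits q using (codeCount; codes-vs-choices; time-lower-bound)

      fewer : codeCount h < choiceCount k h
      fewer = *-cancelˡ-< k _ _ (begin-strict
        k * codeCount h                      ≡⟨ *-comm k (codeCount h) ⟩
        codeCount h * k                      <⟨ m<m+n _ choices>0 ⟩
        codeCount h * k + choiceCount k h    ≤⟨ codes-vs-choices h (λ {l} _ → few-messages bits≤2^β*h l) ⟩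
        k * choiceCount k h                  ∎)
        where
        choices>0 : 0 < choiceCount k h
        choices>0 = subst (0 <_) (sym (choiceCount-2^ h h)) (m^n>0 2 (h * 2 ^ h))

      n*g≤factor*T : n * g ≤ factor * T n
      n*g≤factor*T = begin
        n * g                                  ≤⟨ *-mono-≤ n≤16k² g≤5h ⟩
        16 * (k * k) * (5 * h)                 ≡⟨ regroup₁ k h ⟩
        80 * k * (h * k)                       ≤⟨ *-monoʳ-≤ (80 * k) (bound-q-h 2lowest≤h) ⟩
        80 * k * (4 * 2 ^ (β + 2) * bound q h) ≡⟨ cong (λ k → 80 * k * (4 * 2 ^ (β + 2) * bound q h)) k≡2^cρ ⟨
        80 * (2 ^ c * ρ) * (4 * 2 ^ (β + 2) * bound q h) ≡⟨ regroup₂ (2 ^ c) ρ (2 ^ (β + 2)) (bound q h) ⟩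
        factor * (ρ * bound q h)               ≤⟨ *-monoʳ-≤ factor (time-lower-bound maintains timeBound fewer enough) ⟩
        factor * T n                           ∎
        where
        regroup₁ : ∀ k h → 16 * (k * k) * (5 * h) ≡ 80 * k * (h * k)
        regroup₁ = solve-∀
        regroup₂ : ∀ c ρ b z → 80 * (c * ρ) * (4 * b * z) ≡ 320 * c * b * (ρ * z)
        regroup₂ = solve-∀

  large : ∀ n → 2 ^ (2 * H + 3) + n₁ + n₂ ≤ n → n * ⌊log₂ n ⌋ ≤ factor * T n
  large n n≥
    with h , 2h+2≤g , g≤2h+3 ← half-minus-one (g n n≥)
           (≤-trans (≤-trans (n≤1+n 2) (m≤n+m 3 (2 * H))) (2H+3≤g n n≥))
    = n*g≤factor*T n n≥ h 2h+2≤g g≤2h+3
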